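{- Let $R$ be a commutative ring, $G$ an edge-labeled graph over $R$, and $R_G$ its ring of splines. Flat base change with affine schemes commutes with spline structure morphisms: for every flat commutative $R$-algebra $S$, the $S$-schemes $$\operatorname{Spec}(R_G\otimes_R S)\to \operatorname{Spec}(S)\qquad\text{and}\qquad \operatorname{Spec}(S_{F_S(G)})\to\operatorname{Spec}(S)$$ are isomorphic over $\operatorname{Spec}(S)$, where the first is the base change of the spline structure morphism of $G$ and the second is the spline structure morphism of $F_S(G)$. In particular, if $\mathfrak{p}$ is a prime ideal of $R$ then $(R_G)_{\mathfrak{p}}\cong (R_{\mathfrak{p}})_{G_{\mathfrak{p}}}$, and if $f\in R$ then $(R_G)_f\cong (R_f)_{G_f}$.
   Context: An edge-labeled graph $G$ over $R$ is a finite graph $(V,E)$ with a map $\alpha$ from $E$ to the set of ideals of $R$; write $I_{uv}=\alpha(e_{uv})$ for an edge $e_{uv}$ joining $u$ and $v$. The unit ideal is allowed as a label. A spline is a function $s:V\to R$ with $s(u)-s(v)\in I_{uv}$ for every edge $e_{uv}$; the splines form a ring $R_G$ under pointwise operations. The spline structure morphism of $G$ is the morphism $\operatorname{Spec}(R_G)\to\operatorname{Spec}(R)$ induced by the diagonal ring homomorphism $\Delta:R\to R_G$ sending $r$ to the constant spline with value $r$. For a flat commutative $R$-algebra $S$, $F_S(-)=-\otimes_R S$, and $F_S(G)$ is the edge-labeled graph over $F_S(R)=S$ with the same underlying graph, in which each edge ideal $I_{uv}$ is replaced by $F_S(I_{uv})=I_{uv}\otimes_R S$, identified (by flatness) with the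 ideal $I_{uv}S$ of $S$; $S_{F_S(G)}$ is its ring of splines over $S$. For $f\in R$ write $G_f$ for $F_S(G)$ with $S=R_f$, and for a prime $\mathfrak{p}$ write $G_{\mathfrak{p}}$ for $F_S(G)$ with $S=R_{\mathfrak{p}}$. -}

module Defs where

open import Algebra.Bundles using (CommutativeRing)
open import Algebra.Module.Bundles using (LeftModule)
open import Algebra.Module.Morphism.Structures using (module LeftModuleMorphisms)
open import Algebra.Morphism.Structures using (module RingMorphisms)
import Algebra.Properties.AbelianGroup as AbelianGroupProperties
import Algebra.Properties.Ring as RingProperties
import Algebra.Properties.Semiring.Exp as Exp
import Algebra.Solver.Ring.NaturalCoefficients.Default as Solver
open import Data.Fin.Base using (Fin)
open import Data.Nat.Base as ℕ using (ℕ)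
open import Data.Product.Base using (Σ; ∃; _×_; _,_; proj₁; proj₂)
open import Data.Sum.Base using (_⊎_; inj₁; inj₂; [_,_])
open import Data.Unit.Polymorphic.Base using (⊤; tt)
open import Function.Base using (id; _∘_)
open import Function.Definitions using (Injective)
open import Level using (Level; _⊔_) renaming (suc to lsuc)
open import Relation.Binary.Core using (Rel)
open import Relation.Binary.Structures using (IsEquivalence)
import Relation.Binary.Reasoning.Setoid as SetoidReasoning
open import Relation.Nullary.Negation.Core using (¬_)
open import Relation.Unary using (Pred; _⊆_; _∩_)

private
  variable
    a b c ℓ : Level

CRing : (a : Level) → Set (lsuc a)
CRing a = CommutativeRing a a

-- The commutative ring axioms without the halves that follow from
-- commutativity.

record RingData (a : Level) : Set (lsuc a) where
  infix  4 _≈_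
  infixl 7 _*_
  infixl 6 _+_
  field
    Carrier : Set a
    _≈_     : Rel Carrier a
    _+_ _*_ : Carrier → Carrier → Carrier
    -_      : Carrier → Carrier
    0# 1#   : Carrier
    isEquivalence : IsEquivalence _≈_
    +-cong      : ∀ {x y u v} → x ≈ y → u ≈ v → x + u ≈ y + v
    *-cong      : ∀ {x y u v} → x ≈ y → u ≈ v → x * u ≈ y * v
    -‿cong      : ∀ {x y} → x ≈ y → - x ≈ - y
    +-assoc     : ∀ x y z → (x + y) + z ≈ x + (y + z)
    +-comm      : ∀ x y → x + y ≈ y + x
    +-identityˡ : ∀ x → 0# + x ≈ x
    -‿inverseˡ  : ∀ x → (- x) + x ≈ 0#
    *-assoc     : ∀ x y z → (x * y) * z ≈ x * (y * z)
    *-comm      : ∀ x y → x * y ≈ y * x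
    *-identityˡ : ∀ x → 1# * x ≈ x
    distribʳ    : ∀ x y z → (y + z) * x ≈ y * x + z * x

toCRing : RingData a → CRing a
toCRing D = record
  { Carrier = Carrier ; _≈_ = _≈_ ; _+_ = _+_ ; _*_ = _*_ ; -_ = -_ ; 0# = 0# ; 1# = 1#
  ; isCommutativeRing = record
    { isRing = record
      { +-isAbelianGroup = record
        { isGroup = record
          { isMonoid = record
            { isSemigroup = record
              { isMagma = record { isEquivalence = isEquivalence ; ∙-cong = +-cong }
              ; assoc = +-assoc }
            ; identity = +-identityˡ , λ x → trans (+-comm x 0#) (+-identityˡ x) }
          ; inverse = -‿inverseˡ , λ x → trans (+-comm x (- x)) (-‿inverseˡ x)
          ; ⁻¹-cong = -‿cong }
        ; comm = +-comm }
      ; *-cong = *-cong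
      ; *-assoc = *-assoc
      ; *-identity = *-identityˡ , λ x → trans (*-comm x 1#) (*-identityˡ x)
      ; distrib = (λ x y z → trans (*-comm x (y + z))
                    (trans (distribʳ x y z) (+-cong (*-comm y x) (*-comm z x))))
                , distribʳ }
    ; *-comm = *-comm } }
  where
  open RingData D
  open IsEquivalence isEquivalence using (trans)

record RingHom (A : CRing a) (B : CRing b) : Set (a ⊔ b) where
  private
    module A = CommutativeRing A
    module B = CommutativeRing B
  open RingMorphisms A.rawRing B.rawRing using (IsRingHomomorphism)
  field
    ⟦_⟧ : A.Carrier → B.Carrier
    isRingHomomorphism : IsRingHomomorphism ⟦_⟧
  open RingMorphisms.IsRingHomomorphism isRingHomomorphism public

module _ {A : CRing a} {B : CRing b} where
  private
    module A = CommutativeRing A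
    module B = CommutativeRing B

  mkRingHom : (f : A.Carrier → B.Carrier) →
              (∀ {x y} → x A.≈ y → f x B.≈ f y) →
              (∀ x y → f (x A.+ y) B.≈ f x B.+ f y) →
              (∀ x y → f (x A.* y) B.≈ f x B.* f y) →
              (∀ x → f (A.- x) B.≈ B.- f x) →
              f A.0# B.≈ B.0# → f A.1# B.≈ B.1# → RingHom A B
  mkRingHom f cong + * - 0# 1# = record
    { ⟦_⟧ = f
    ; isRingHomomorphism = record
      { isSemiringHomomorphism = record
        { isNearSemiringHomomorphism = record
          { +-isMonoidHomomorphism = record
            { isMagmaHomomorphism = record
              { isRelHomomorphism = record { cong = cong } ; homo = + }
            ; ε-homo = 0# }
          ; *-homo = * }
        ; 1#-homo = 1# }
      ; -‿homo = - } }

idHom : {A : CRing a} → RingHom A A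
idHom {A = A} = mkRingHom id id (λ _ _ → refl) (λ _ _ → refl) (λ _ → refl) refl refl
  where open CommutativeRing A using (refl)

infixr 9 _∘ʰ_
_∘ʰ_ : {A : CRing a} {B : CRing b} {C : CRing c} → RingHom B C → RingHom A B → RingHom A C
_∘ʰ_ {C = C} g f = mkRingHom (G.⟦_⟧ ∘ F.⟦_⟧) (G.⟦⟧-cong ∘ F.⟦⟧-cong)
  (λ x y → trans (G.⟦⟧-cong (F.+-homo x y)) (G.+-homo _ _))
  (λ x y → trans (G.⟦⟧-cong (F.*-homo x y)) (G.*-homo _ _))
  (λ x → trans (G.⟦⟧-cong (F.-‿homo x)) (G.-‿homo _))
  (trans (G.⟦⟧-cong F.0#-homo) G.0#-homo)
  (trans (G.⟦⟧-cong F.1#-homo) G.1#-homo)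
  where
  module F = RingHom f
  module G = RingHom g
  open CommutativeRing C using (trans)

-- α : R → A and β : R → B exhibit A and B as R-algebras.

record AlgebraIso {R : CRing a} {A : CRing b} {B : CRing c}
                  (α : RingHom R A) (β : RingHom R B) : Set (a ⊔ b ⊔ c) where
  private
    module A = CommutativeRing A
    module B = CommutativeRing B
  open RingMorphisms A.rawRing B.rawRing using (IsRingIsomorphism)
  field
    to : A.Carrier → B.Carrier
    isRingIsomorphism : IsRingIsomorphism to
    commutes : ∀ r → to (RingHom.⟦_⟧ α r) B.≈ RingHom.⟦_⟧ β r

record Ideal (R : CRing ℓ) : Set (lsuc ℓ) where
  open CommutativeRing R
  infix 4 _∈I
  field
    _∈I      : Pred Carrier ℓ
    ∈-resp-≈ : ∀ {x y} → x ≈ y → x ∈I → y ∈I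
    0∈       : 0# ∈I
    +-closed : ∀ {x y} → x ∈I → y ∈I → x + y ∈I
    *-closed : ∀ r {x} → x ∈I → r * x ∈I

record PrimeIdeal (R : CRing ℓ) : Set (lsuc ℓ) where
  open CommutativeRing R using (Carrier; 1#; _*_)
  field
    ideal : Ideal R
  open Ideal ideal public
  infix 4 _∉I
  _∉I : Pred Carrier ℓ
  x ∉I = ¬ x ∈I
  field
    1∉    : 1# ∉I
    prime : ∀ x y → x * y ∈I → x ∈I ⊎ y ∈I

  ∉-* : ∀ {x y} → x ∉I → y ∉I → x * y ∉I
  ∉-* x∉ y∉ xy∈ = [ x∉ , y∉ ] (prime _ _ xy∈)

  *-∉ˡ : ∀ {x y} → x * y ∉I → x ∉I
  *-∉ˡ {x} {y} xy∉ x∈ = xy∉ (∈-resp-≈ (CommutativeRing.*-comm R y x) (*-closed y x∈))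

  *-∉ʳ : ∀ {x y} → x * y ∉I → y ∉I
  *-∉ʳ {x} xy∉ y∈ = xy∉ (*-closed x y∈)

record MultiplicativeSet (A : CRing ℓ) : Set (lsuc ℓ) where
  open CommutativeRing A
  infix 4 _∈M
  field
    _∈M      : Pred Carrier ℓ
    ∈-resp-≈ : ∀ {x y} → x ≈ y → x ∈M → y ∈M
    1∈       : 1# ∈M
    *-closed : ∀ {x y} → x ∈M → y ∈M → x * y ∈M

complement : {A : CRing ℓ} → PrimeIdeal A → MultiplicativeSet A
complement {A = A} p = record
  { _∈M = _∉I
  ; ∈-resp-≈ = λ x≈y x∉ y∈ → x∉ (∈-resp-≈ (sym x≈y) y∈)
  ; 1∈ = 1∉
  ; *-closed = ∉-* }
  where
  open PrimeIdeal p
  open CommutativeRing A using (sym)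

powers : (A : CRing ℓ) → CommutativeRing.Carrier A → MultiplicativeSet A
powers A f = record
  { _∈M = λ x → ∃ λ n → x ≈ f ^ n
  ; ∈-resp-≈ = λ { x≈y (n , x≈fⁿ) → n , trans (sym x≈y) x≈fⁿ }
  ; 1∈ = 0 , refl
  ; *-closed = λ { (m , x≈) (n , y≈) →
      m ℕ.+ n , trans (*-cong x≈ y≈) (sym (^-homo-* f m n)) } }
  where
  open CommutativeRing A
  open Exp semiring

image : {A : CRing ℓ} {B : CRing ℓ} → RingHom A B → MultiplicativeSet A → MultiplicativeSet B
image {A = A} {B} φ M = record
  { _∈M = λ y → ∃ λ x → (x ∈M) × (φ.⟦ x ⟧ ≈ y)
  ; ∈-resp-≈ = λ { y≈z (x , x∈ , e) → x , x∈ , trans e y≈z }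
  ; 1∈ = CommutativeRing.1# A , 1∈ , φ.1#-homo
  ; *-closed = λ { (x , x∈ , e) (x′ , x′∈ , e′) →
      _ , *-closed x∈ x′∈ , trans (φ.*-homo x x′) (*-cong e e′) } }
  where
  module φ = RingHom φ
  open MultiplicativeSet M
  open CommutativeRing B using (_≈_; trans; *-cong)

record Fraction (A : CRing ℓ) (M : MultiplicativeSet A) : Set ℓ where
  constructor frac
  open CommutativeRing A using (Carrier)
  open MultiplicativeSet M using (_∈M)
  field
    num  : Carrier
    den  : Carrier
    den∈ : den ∈M
open Fraction

module Localize (A : CRing ℓ) (M : MultiplicativeSet A) where
  open CommutativeRing A
  open MultiplicativeSet M using (_∈M; 1∈; *-closed)
  open RingProperties ring using (-‿distribˡ-*)
  open Solver commutativeSemiring using (solve; _:=_; _:+_; _:*_; con)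
  open SetoidReasoning setoid

  infix 4 _~_
  record _~_ (p q : Fraction A M) : Set ℓ where
    constructor via
    field
      witness   : Carrier
      witness∈  : witness ∈M
      identity~ : witness * (num p * den q) ≈ witness * (num q * den p)

  ≈⇒~ : ∀ {p q : Fraction A M} → num p * den q ≈ num q * den p → p ~ q
  ≈⇒~ e = via 1# 1∈ (*-congˡ e)

  ~-trans : ∀ {p q r} → p ~ q → q ~ r → p ~ r
  ~-trans {frac x s _} {frac y t t∈} {frac z r _} (via u u∈ e) (via v v∈ e′) =
    via ((u * v) * t) (*-closed (*-closed u∈ v∈) t∈) (begin
      ((u * v) * t) * (x * r)   ≈⟨ solve 5 (λ u v t x r → ((u :* v) :* t) :* (x :* r) := (v :* r) :* (u :* (x :* t))) refl u v t x r ⟩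
      (v * r) * (u * (x * t))   ≈⟨ *-congˡ e ⟩
      (v * r) * (u * (y * s))   ≈⟨ solve 5 (λ u v s y r → (v :* r) :* (u :* (y :* s)) := (u :* s) :* (v :* (y :* r))) refl u v s y r ⟩
      (u * s) * (v * (y * r))   ≈⟨ *-congˡ e′ ⟩
      (u * s) * (v * (z * t))   ≈⟨ solve 5 (λ u v s t z → (u :* s) :* (v :* (z :* t)) := ((u :* v) :* t) :* (z :* s)) refl u v s t z ⟩
      ((u * v) * t) * (z * s)   ∎)

  ~-isEquivalence : IsEquivalence _~_
  ~-isEquivalence = record
    { refl = ≈⇒~ refl
    ; sym = λ { (via u u∈ e) → via u u∈ (sym e) }
    ; trans = ~-trans }

  infixl 6 _+ᶠ_
  infixl 7 _*ᶠ_
  _+ᶠ_ _*ᶠ_ : Fraction A M → Fraction A M → Fraction A M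
  frac x s s∈ +ᶠ frac y t t∈ = frac (x * t + y * s) (s * t) (*-closed s∈ t∈)
  frac x s s∈ *ᶠ frac y t t∈ = frac (x * y) (s * t) (*-closed s∈ t∈)

  -ᶠ_ : Fraction A M → Fraction A M
  -ᶠ frac x s s∈ = frac (- x) s s∈

  0ᶠ 1ᶠ : Fraction A M
  0ᶠ = frac 0# 1# 1∈
  1ᶠ = frac 1# 1# 1∈

  +ᶠ-cong : ∀ {p p′ q q′} → p ~ p′ → q ~ q′ → p +ᶠ q ~ p′ +ᶠ q′
  +ᶠ-cong {frac x s _} {frac x′ s′ _} {frac y t _} {frac y′ t′ _} (via u u∈ e) (via v v∈ e′) =
    via (u * v) (*-closed u∈ v∈) (begin
      (u * v) * ((x * t + y * s) * (s′ * t′))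
        ≈⟨ solve 8 (λ u v x s s′ y t t′ → (u :* v) :* ((x :* t :+ y :* s) :* (s′ :* t′)) := (v :* (t :* t′)) :* (u :* (x :* s′)) :+ (u :* (s :* s′)) :* (v :* (y :* t′))) refl u v x s s′ y t t′ ⟩
      (v * (t * t′)) * (u * (x * s′)) + (u * (s * s′)) * (v * (y * t′))
        ≈⟨ +-cong (*-congˡ e) (*-congˡ e′) ⟩
      (v * (t * t′)) * (u * (x′ * s)) + (u * (s * s′)) * (v * (y′ * t))
        ≈⟨ solve 8 (λ u v x′ s s′ y′ t t′ → (v :* (t :* t′)) :* (u :* (x′ :* s)) :+ (u :* (s :* s′)) :* (v :* (y′ :* t)) := (u :* v) :* ((x′ :* t′ :+ y′ :* s′) :* (s :* t))) refl u v x′ s s′ y′ t t′ ⟩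
      (u * v) * ((x′ * t′ + y′ * s′) * (s * t)) ∎)

  *ᶠ-cong : ∀ {p p′ q q′} → p ~ p′ → q ~ q′ → p *ᶠ q ~ p′ *ᶠ q′
  *ᶠ-cong {frac x s _} {frac x′ s′ _} {frac y t _} {frac y′ t′ _} (via u u∈ e) (via v v∈ e′) =
    via (u * v) (*-closed u∈ v∈) (begin
      (u * v) * ((x * y) * (s′ * t′))
        ≈⟨ solve 6 (λ u v x s′ y t′ → (u :* v) :* ((x :* y) :* (s′ :* t′)) := (u :* (x :* s′)) :* (v :* (y :* t′))) refl u v x s′ y t′ ⟩
      (u * (x * s′)) * (v * (y * t′))
        ≈⟨ *-cong e e′ ⟩
      (u * (x′ * s)) * (v * (y′ * t))
        ≈⟨ solve 6 (λ u v x′ s y′ t → (u :* (x′ :* s)) :* (v :* (y′ :* t)) := (u :* v) :* ((x′ :* y′) :* (s :* t))) refl u v x′ s y′ t ⟩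
      (u * v) * ((x′ * y′) * (s * t)) ∎)

  -ᶠ-cong : ∀ {p q} → p ~ q → -ᶠ p ~ -ᶠ q
  -ᶠ-cong {frac x s _} {frac y t _} (via u u∈ e) = via u u∈ (begin
    u * (- x * t)     ≈⟨ neg u x t ⟩
    - (u * (x * t))   ≈⟨ -‿cong e ⟩
    - (u * (y * s))   ≈⟨ sym (neg u y s) ⟩
    u * (- y * s)     ∎)
    where
    open RingProperties ring using (-‿distribʳ-*)
    neg : ∀ u x t → u * (- x * t) ≈ - (u * (x * t))
    neg u x t = trans (*-congˡ (sym (-‿distribˡ-* x t))) (sym (-‿distribʳ-* u (x * t)))

  ring[M⁻¹] : CRing ℓ
  ring[M⁻¹] = toCRing record
    { Carrier = Fraction A M ; _≈_ = _~_
    ; _+_ = _+ᶠ_ ; _*_ = _*ᶠ_ ; -_ = -ᶠ_ ; 0# = 0ᶠ ; 1# = 1ᶠ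
    ; isEquivalence = ~-isEquivalence
    ; +-cong = +ᶠ-cong
    ; *-cong = *ᶠ-cong
    ; -‿cong = -ᶠ-cong
    ; +-assoc = λ { (frac x s _) (frac y t _) (frac z r _) → ≈⇒~
        (solve 6 (λ x s y t z r → ((x :* t :+ y :* s) :* r :+ z :* (s :* t)) :* (s :* (t :* r))
                               := (x :* (t :* r) :+ (y :* r :+ z :* t) :* s) :* ((s :* t) :* r)) refl x s y t z r) }
    ; +-comm = λ { (frac x s _) (frac y t _) → ≈⇒~
        (solve 4 (λ x s y t → (x :* t :+ y :* s) :* (t :* s) := (y :* s :+ x :* t) :* (s :* t)) refl x s y t) }
    ; +-identityˡ = λ { (frac x s _) → ≈⇒~
        (solve 2 (λ x s → (con 0 :* s :+ x :* con 1) :* s := x :* (con 1 :* s)) refl x s) }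
    ; -‿inverseˡ = λ { (frac x s _) → ≈⇒~ (begin
        (- x * s + x * s) * 1#  ≈⟨ *-congʳ (trans (sym (distribʳ s (- x) x)) (*-congʳ (-‿inverseˡ x))) ⟩
        (0# * s) * 1#           ≈⟨ solve 1 (λ s → (con 0 :* s) :* con 1 := con 0 :* (s :* s)) refl s ⟩
        0# * (s * s)            ∎) }
    ; *-assoc = λ { (frac x s _) (frac y t _) (frac z r _) → ≈⇒~
        (solve 6 (λ x s y t z r → ((x :* y) :* z) :* (s :* (t :* r)) := (x :* (y :* z)) :* ((s :* t) :* r)) refl x s y t z r) }
    ; *-comm = λ { (frac x s _) (frac y t _) → ≈⇒~
        (solve 4 (λ x s y t → (x :* y) :* (t :* s) := (y :* x) :* (s :* t)) refl x s y t) }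
    ; *-identityˡ = λ { (frac x s _) → ≈⇒~
        (solve 2 (λ x s → (con 1 :* x) :* s := x :* (con 1 :* s)) refl x s) }
    ; distribʳ = λ { (frac x s _) (frac y t _) (frac z r _) → ≈⇒~
        (solve 6 (λ x s y t z r → ((y :* r :+ z :* t) :* x) :* ((t :* s) :* (r :* s))
                               := ((y :* x) :* (r :* s) :+ (z :* x) :* (t :* s)) :* ((t :* r) :* s)) refl x s y t z r) }
    }

  toLocalization : RingHom A ring[M⁻¹]
  toLocalization = mkRingHom (λ x → frac x 1# 1∈)
    (λ e → ≈⇒~ (*-congʳ e))
    (λ x y → ≈⇒~ (solve 2 (λ x y → (x :+ y) :* (con 1 :* con 1) := (x :* con 1 :+ y :* con 1) :* con 1) refl x y))
    (λ x y → ≈⇒~ (solve 2 (λ x y → (x :* y) :* (con 1 :* con 1) := (x :* y) :* con 1) refl x y))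
    (λ x → ≈⇒~ refl) (≈⇒~ refl) (≈⇒~ refl)

open Localize public using (toLocalization) renaming (ring[M⁻¹] to localization)

-- The homomorphism A[M⁻¹] → B[N⁻¹] induced by φ : A → B with φ(M) ⊆ N.

localizeHom : {A : CRing ℓ} {B : CRing ℓ} (φ : RingHom A B)
              (M : MultiplicativeSet A) (N : MultiplicativeSet B) →
              (∀ {x} → MultiplicativeSet._∈M M x → MultiplicativeSet._∈M N (RingHom.⟦_⟧ φ x)) →
              RingHom (localization A M) (localization B N)
localizeHom {A = A} {B} φ M N φM⊆N = mkRingHom
  (λ { (frac x s s∈) → frac φ.⟦ x ⟧ φ.⟦ s ⟧ (φM⊆N s∈) })
  (λ { {frac x s _} {frac y t _} (Localize.via u u∈ e) →
     via φ.⟦ u ⟧ (φM⊆N u∈) (trans (sym (homo₃ u x t)) (trans (φ.⟦⟧-cong e) (homo₃ u y s))) })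
  (λ { (frac x s _) (frac y t _) → ≈⇒~ (*-cong
     (trans (φ.+-homo _ _) (+-cong (φ.*-homo x t) (φ.*-homo y s))) (sym (φ.*-homo s t))) })
  (λ { (frac x s _) (frac y t _) → ≈⇒~ (*-cong (φ.*-homo x y) (sym (φ.*-homo s t))) })
  (λ { (frac x s _) → ≈⇒~ (*-congʳ (φ.-‿homo x)) })
  (≈⇒~ (*-cong φ.0#-homo (sym φ.1#-homo)))
  (≈⇒~ (*-cong φ.1#-homo (sym φ.1#-homo)))
  where
  module φ = RingHom φ
  open CommutativeRing B
  open Localize B N using (≈⇒~; via)
  module A = CommutativeRing A
  homo₃ : ∀ u x t → φ.⟦ u A.* (x A.* t) ⟧ ≈ φ.⟦ u ⟧ * (φ.⟦ x ⟧ * φ.⟦ t ⟧)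
  homo₃ u x t = trans (φ.*-homo u _) (*-congˡ (φ.*-homo x t))

-- Over a commutative ring, modules are left modules.

RModule : CRing ℓ → Set (lsuc ℓ)
RModule {ℓ} R = LeftModule (CommutativeRing.ring R) ℓ ℓ

asModule : {R S : CRing ℓ} → RingHom R S → RModule R
asModule {R = R} {S} φ = record
  { Carrierᴹ = Carrier ; _≈ᴹ_ = _≈_ ; _+ᴹ_ = _+_
  ; _*ₗ_ = λ r x → φ.⟦ r ⟧ * x
  ; 0ᴹ = 0# ; -ᴹ_ = -_
  ; isLeftModule = record
    { isLeftSemimodule = record
      { +ᴹ-isCommutativeMonoid = +-isCommutativeMonoid
      ; isPreleftSemimodule = record
        { *ₗ-cong = λ e e′ → *-cong (φ.⟦⟧-cong e) e′
        ; *ₗ-zeroˡ = λ x → trans (*-congʳ φ.0#-homo) (zeroˡ x)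
        ; *ₗ-distribʳ = λ x r s → trans (*-congʳ (φ.+-homo r s)) (distribʳ x _ _)
        ; *ₗ-identityˡ = λ x → trans (*-congʳ φ.1#-homo) (*-identityˡ x)
        ; *ₗ-assoc = λ r s x → trans (*-congʳ (φ.*-homo r s)) (*-assoc _ _ x)
        ; *ₗ-zeroʳ = λ r → zeroʳ _
        ; *ₗ-distribˡ = λ r x y → distribˡ _ x y } }
    ; -ᴹ‿cong = -‿cong
    ; -ᴹ‿inverse = -‿inverse } }
  where
  module φ = RingHom φ
  open CommutativeRing S

-- M ⊗ N is the abelian group generated by the symbols x ⊗ y subject to
-- biadditivity and r x ⊗ y = x ⊗ r y.

module _ (R : CRing ℓ) where

  infixl 6 _⊕_
  infix  7 _⊗_
  data Tensor (M N : RModule R) : Set ℓ where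
    _⊗_ : LeftModule.Carrierᴹ M → LeftModule.Carrierᴹ N → Tensor M N
    𝟎   : Tensor M N
    _⊕_ : Tensor M N → Tensor M N → Tensor M N
    ⊖_  : Tensor M N → Tensor M N

module _ {R : CRing ℓ} where

  module _ {M N : RModule R} where
    private
      module M = LeftModule M
      module N = LeftModule N

    infix 4 _≈⊗_
    data _≈⊗_ : Rel (Tensor R M N) ℓ where
      ≈refl  : ∀ {s} → s ≈⊗ s
      ≈sym   : ∀ {s t} → s ≈⊗ t → t ≈⊗ s
      ≈trans : ∀ {s t u} → s ≈⊗ t → t ≈⊗ u → s ≈⊗ u
      ⊕-cong : ∀ {s s′ t t′} → s ≈⊗ s′ → t ≈⊗ t′ → s ⊕ t ≈⊗ s′ ⊕ t′
      ⊖-cong : ∀ {s t} → s ≈⊗ t → ⊖ s ≈⊗ ⊖ t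
      ⊕-assoc     : ∀ s t u → (s ⊕ t) ⊕ u ≈⊗ s ⊕ (t ⊕ u)
      ⊕-comm      : ∀ s t → s ⊕ t ≈⊗ t ⊕ s
      ⊕-identityˡ : ∀ s → 𝟎 ⊕ s ≈⊗ s
      ⊖-inverseˡ  : ∀ s → (⊖ s) ⊕ s ≈⊗ 𝟎
      ⊗-cong      : ∀ {x x′ y y′} → x M.≈ᴹ x′ → y N.≈ᴹ y′ → x ⊗ y ≈⊗ x′ ⊗ y′
      ⊗-distribʳ  : ∀ x x′ y → (x M.+ᴹ x′) ⊗ y ≈⊗ x ⊗ y ⊕ x′ ⊗ y
      ⊗-distribˡ  : ∀ x y y′ → x ⊗ (y N.+ᴹ y′) ≈⊗ x ⊗ y ⊕ x ⊗ y′
      ⊗-balanced  : ∀ r x y → (r M.*ₗ x) ⊗ y ≈⊗ x ⊗ (r N.*ₗ y)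

  module _ {M M′ : RModule R} (N : RModule R)
           (f : LeftModule.Carrierᴹ M → LeftModule.Carrierᴹ M′) where

    infix 8 _⊗id
    _⊗id : Tensor R M N → Tensor R M′ N
    _⊗id (x ⊗ y) = f x ⊗ y
    _⊗id 𝟎       = 𝟎
    _⊗id (s ⊕ t) = _⊗id s ⊕ _⊗id t
    _⊗id (⊖ s)   = ⊖ _⊗id s

-- As - ⊗ S is right exact, flatness is preservation of injections.

Flat : {R S : CRing ℓ} → RingHom R S → Set (lsuc ℓ)
Flat {R = R} φ = (M N : RModule R) (let module M = LeftModule M ; module N = LeftModule N)
  (f : M.Carrierᴹ → N.Carrierᴹ) →
  LeftModuleMorphisms.IsLeftModuleMonomorphism M.rawLeftModule N.rawLeftModule f →
  Injective _≈⊗_ _≈⊗_ (_⊗id {R = R} {M} {N} (asModule φ) f)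

module TensorAlgebra {R A B : CRing ℓ} (α : RingHom R A) (β : RingHom R B) where
  private
    module A = CommutativeRing A
    module B = CommutativeRing B
    module α = RingHom α
    module β = RingHom β

  T : Set ℓ
  T = Tensor R (asModule α) (asModule β)

  scale : A.Carrier → B.Carrier → T → T
  scale x y (x′ ⊗ y′) = (x A.* x′) ⊗ (y B.* y′)
  scale x y 𝟎         = 𝟎
  scale x y (s ⊕ t)   = scale x y s ⊕ scale x y t
  scale x y (⊖ s)     = ⊖ scale x y s

  infixl 7 _·_
  _·_ : T → T → T
  (x ⊗ y) · t = scale x y t
  𝟎 · t       = 𝟎
  (s ⊕ u) · t = s · t ⊕ u · t
  (⊖ s) · t   = ⊖ (s · t)

  private
    swap₄ : ∀ (s t u v : T) → (s ⊕ t) ⊕ (u ⊕ v) ≈⊗ (s ⊕ u) ⊕ (t ⊕ v)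
    swap₄ s t u v = ≈trans (⊕-assoc s t (u ⊕ v)) (≈trans (⊕-cong ≈refl
      (≈trans (≈sym (⊕-assoc t u v)) (≈trans (⊕-cong (⊕-comm t u) ≈refl) (⊕-assoc u t v))))
      (≈sym (⊕-assoc s u (t ⊕ v))))

    ⊖-unique : ∀ {s t : T} → s ⊕ t ≈⊗ 𝟎 → s ≈⊗ ⊖ t
    ⊖-unique {s} {t} e = ≈trans (≈trans (≈sym (≈trans (⊕-comm s 𝟎) (⊕-identityˡ s)))
      (⊕-cong ≈refl (≈sym (≈trans (⊕-comm t (⊖ t)) (⊖-inverseˡ t)))))
      (≈trans (≈sym (⊕-assoc s t (⊖ t))) (≈trans (⊕-cong e ≈refl) (⊕-identityˡ (⊖ t))))

    𝟎⊕𝟎 : 𝟎 ≈⊗ 𝟎 ⊕ (𝟎 {R = R} {asModule α} {asModule β})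
    𝟎⊕𝟎 = ≈sym (⊕-identityˡ 𝟎)

    ⊖-⊕ : ∀ (s t : T) → ⊖ (s ⊕ t) ≈⊗ ⊖ s ⊕ ⊖ t
    ⊖-⊕ s t = ≈sym (⊖-unique (≈trans (swap₄ (⊖ s) (⊖ t) s t)
      (≈trans (⊕-cong (⊖-inverseˡ s) (⊖-inverseˡ t)) (⊕-identityˡ 𝟎))))

    scale-cong : ∀ {x x′ y y′} → x A.≈ x′ → y B.≈ y′ → ∀ t → scale x y t ≈⊗ scale x′ y′ t
    scale-cong e e′ (x ⊗ y) = ⊗-cong (A.*-congʳ e) (B.*-congʳ e′)
    scale-cong e e′ 𝟎       = ≈refl
    scale-cong e e′ (s ⊕ t) = ⊕-cong (scale-cong e e′ s) (scale-cong e e′ t)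
    scale-cong e e′ (⊖ s)   = ⊖-cong (scale-cong e e′ s)

    scale-congʳ : ∀ x y {s t} → s ≈⊗ t → scale x y s ≈⊗ scale x y t
    scale-congʳ x y ≈refl = ≈refl
    scale-congʳ x y (≈sym e) = ≈sym (scale-congʳ x y e)
    scale-congʳ x y (≈trans e e′) = ≈trans (scale-congʳ x y e) (scale-congʳ x y e′)
    scale-congʳ x y (⊕-cong e e′) = ⊕-cong (scale-congʳ x y e) (scale-congʳ x y e′)
    scale-congʳ x y (⊖-cong e) = ⊖-cong (scale-congʳ x y e)
    scale-congʳ x y (⊕-assoc s t u) = ⊕-assoc _ _ _
    scale-congʳ x y (⊕-comm s t) = ⊕-comm _ _
    scale-congʳ x y (⊕-identityˡ s) = ⊕-identityˡ _
    scale-congʳ x y (⊖-inverseˡ s) = ⊖-inverseˡ _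
    scale-congʳ x y (⊗-cong e e′) = ⊗-cong (A.*-congˡ e) (B.*-congˡ e′)
    scale-congʳ x y (⊗-distribʳ p q r) =
      ≈trans (⊗-cong (A.distribˡ x p q) B.refl) (⊗-distribʳ _ _ _)
    scale-congʳ x y (⊗-distribˡ p q r) =
      ≈trans (⊗-cong A.refl (B.distribˡ y q r)) (⊗-distribˡ _ _ _)
    scale-congʳ x y (⊗-balanced r p q) =
      ≈trans (⊗-cong (commA x α.⟦ r ⟧ p) B.refl)
        (≈trans (⊗-balanced r _ _) (⊗-cong A.refl (B.sym (commB y β.⟦ r ⟧ q))))
      where
      commA : ∀ x r p → x A.* (r A.* p) A.≈ r A.* (x A.* p)
      commA x r p = A.trans (A.sym (A.*-assoc x r p))
        (A.trans (A.*-congʳ (A.*-comm x r)) (A.*-assoc r x p))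
      commB : ∀ x r p → x B.* (r B.* p) B.≈ r B.* (x B.* p)
      commB x r p = B.trans (B.sym (B.*-assoc x r p))
        (B.trans (B.*-congʳ (B.*-comm x r)) (B.*-assoc r x p))

    scale-+ˡ : ∀ x x′ y t → scale (x A.+ x′) y t ≈⊗ scale x y t ⊕ scale x′ y t
    scale-+ˡ x x′ y (p ⊗ q) = ≈trans (⊗-cong (A.distribʳ p x x′) B.refl) (⊗-distribʳ _ _ _)
    scale-+ˡ x x′ y 𝟎       = 𝟎⊕𝟎
    scale-+ˡ x x′ y (s ⊕ t) = ≈trans (⊕-cong (scale-+ˡ x x′ y s) (scale-+ˡ x x′ y t)) (swap₄ _ _ _ _)
    scale-+ˡ x x′ y (⊖ s)   = ≈trans (⊖-cong (scale-+ˡ x x′ y s)) (⊖-⊕ _ _)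

    scale-+ʳ : ∀ x y y′ t → scale x (y B.+ y′) t ≈⊗ scale x y t ⊕ scale x y′ t
    scale-+ʳ x y y′ (p ⊗ q) = ≈trans (⊗-cong A.refl (B.distribʳ q y y′)) (⊗-distribˡ _ _ _)
    scale-+ʳ x y y′ 𝟎       = 𝟎⊕𝟎
    scale-+ʳ x y y′ (s ⊕ t) = ≈trans (⊕-cong (scale-+ʳ x y y′ s) (scale-+ʳ x y y′ t)) (swap₄ _ _ _ _)
    scale-+ʳ x y y′ (⊖ s)   = ≈trans (⊖-cong (scale-+ʳ x y y′ s)) (⊖-⊕ _ _)

    scale-balanced : ∀ r x y t → scale (α.⟦ r ⟧ A.* x) y t ≈⊗ scale x (β.⟦ r ⟧ B.* y) t
    scale-balanced r x y (p ⊗ q) = ≈trans (⊗-cong (A.*-assoc _ x p) B.refl)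
      (≈trans (⊗-balanced r _ _) (⊗-cong A.refl (B.sym (B.*-assoc _ y q))))
    scale-balanced r x y 𝟎       = ≈refl
    scale-balanced r x y (s ⊕ t) = ⊕-cong (scale-balanced r x y s) (scale-balanced r x y t)
    scale-balanced r x y (⊖ s)   = ⊖-cong (scale-balanced r x y s)

    ·-congʳ : ∀ s {t t′} → t ≈⊗ t′ → s · t ≈⊗ s · t′
    ·-congʳ (x ⊗ y) e = scale-congʳ x y e
    ·-congʳ 𝟎       e = ≈refl
    ·-congʳ (s ⊕ u) e = ⊕-cong (·-congʳ s e) (·-congʳ u e)
    ·-congʳ (⊖ s)   e = ⊖-cong (·-congʳ s e)

    ·-congˡ : ∀ {s s′} t → s ≈⊗ s′ → s · t ≈⊗ s′ · t
    ·-congˡ t ≈refl = ≈refl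
    ·-congˡ t (≈sym e) = ≈sym (·-congˡ t e)
    ·-congˡ t (≈trans e e′) = ≈trans (·-congˡ t e) (·-congˡ t e′)
    ·-congˡ t (⊕-cong e e′) = ⊕-cong (·-congˡ t e) (·-congˡ t e′)
    ·-congˡ t (⊖-cong e) = ⊖-cong (·-congˡ t e)
    ·-congˡ t (⊕-assoc s u v) = ⊕-assoc _ _ _
    ·-congˡ t (⊕-comm s u) = ⊕-comm _ _
    ·-congˡ t (⊕-identityˡ s) = ⊕-identityˡ _
    ·-congˡ t (⊖-inverseˡ s) = ⊖-inverseˡ _
    ·-congˡ t (⊗-cong e e′) = scale-cong e e′ t
    ·-congˡ t (⊗-distribʳ p q r) = scale-+ˡ p q r t
    ·-congˡ t (⊗-distribˡ p q r) = scale-+ʳ p q r t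
    ·-congˡ t (⊗-balanced r p q) = scale-balanced r p q t

    ·-distribˡ : ∀ s t u → s · (t ⊕ u) ≈⊗ s · t ⊕ s · u
    ·-distribˡ (x ⊗ y) t u = ≈refl
    ·-distribˡ 𝟎       t u = 𝟎⊕𝟎
    ·-distribˡ (s ⊕ v) t u = ≈trans (⊕-cong (·-distribˡ s t u) (·-distribˡ v t u)) (swap₄ _ _ _ _)
    ·-distribˡ (⊖ s)   t u = ≈trans (⊖-cong (·-distribˡ s t u)) (⊖-⊕ _ _)

    ⊖𝟎 : ⊖ 𝟎 ≈⊗ (𝟎 {R = R} {asModule α} {asModule β})
    ⊖𝟎 = ≈sym (⊖-unique (⊕-identityˡ 𝟎))

    ·-zeroʳ : ∀ s → s · 𝟎 ≈⊗ 𝟎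
    ·-zeroʳ (x ⊗ y) = ≈refl
    ·-zeroʳ 𝟎       = ≈refl
    ·-zeroʳ (s ⊕ t) = ≈trans (⊕-cong (·-zeroʳ s) (·-zeroʳ t)) (⊕-identityˡ 𝟎)
    ·-zeroʳ (⊖ s)   = ≈trans (⊖-cong (·-zeroʳ s)) ⊖𝟎

    ·-⊖ʳ : ∀ s t → s · (⊖ t) ≈⊗ ⊖ (s · t)
    ·-⊖ʳ (x ⊗ y) t = ≈refl
    ·-⊖ʳ 𝟎       t = ≈sym ⊖𝟎
    ·-⊖ʳ (s ⊕ u) t = ≈trans (⊕-cong (·-⊖ʳ s t) (·-⊖ʳ u t)) (≈sym (⊖-⊕ _ _))
    ·-⊖ʳ (⊖ s)   t = ⊖-cong (·-⊖ʳ s t)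

    ·-comm : ∀ s t → s · t ≈⊗ t · s
    ·-comm (x ⊗ y) (x′ ⊗ y′) = ⊗-cong (A.*-comm x x′) (B.*-comm y y′)
    ·-comm (x ⊗ y) 𝟎         = ≈refl
    ·-comm (x ⊗ y) (s ⊕ t)   = ⊕-cong (·-comm (x ⊗ y) s) (·-comm (x ⊗ y) t)
    ·-comm (x ⊗ y) (⊖ s)     = ⊖-cong (·-comm (x ⊗ y) s)
    ·-comm 𝟎       t = ≈sym (·-zeroʳ t)
    ·-comm (s ⊕ u) t = ≈trans (⊕-cong (·-comm s t) (·-comm u t)) (≈sym (·-distribˡ t s u))
    ·-comm (⊖ s)   t = ≈trans (⊖-cong (·-comm s t)) (≈sym (·-⊖ʳ t s))

    scale-scale : ∀ x y x′ y′ t → scale (x A.* x′) (y B.* y′) t ≈⊗ scale x y (scale x′ y′ t)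
    scale-scale x y x′ y′ (p ⊗ q) = ⊗-cong (A.*-assoc x x′ p) (B.*-assoc y y′ q)
    scale-scale x y x′ y′ 𝟎       = ≈refl
    scale-scale x y x′ y′ (s ⊕ t) = ⊕-cong (scale-scale x y x′ y′ s) (scale-scale x y x′ y′ t)
    scale-scale x y x′ y′ (⊖ s)   = ⊖-cong (scale-scale x y x′ y′ s)

    scale-· : ∀ x y t u → scale x y t · u ≈⊗ scale x y (t · u)
    scale-· x y (x′ ⊗ y′) u = scale-scale x y x′ y′ u
    scale-· x y 𝟎         u = ≈refl
    scale-· x y (s ⊕ t)   u = ⊕-cong (scale-· x y s u) (scale-· x y t u)
    scale-· x y (⊖ s)     u = ⊖-cong (scale-· x y s u)

    ·-assoc : ∀ s t u → (s · t) · u ≈⊗ s · (t · u)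
    ·-assoc (x ⊗ y) t u = scale-· x y t u
    ·-assoc 𝟎       t u = ≈refl
    ·-assoc (s ⊕ v) t u = ⊕-cong (·-assoc s t u) (·-assoc v t u)
    ·-assoc (⊖ s)   t u = ⊖-cong (·-assoc s t u)

    ·-identityˡ : ∀ t → (A.1# ⊗ B.1#) · t ≈⊗ t
    ·-identityˡ (x ⊗ y) = ⊗-cong (A.*-identityˡ x) (B.*-identityˡ y)
    ·-identityˡ 𝟎       = ≈refl
    ·-identityˡ (s ⊕ t) = ⊕-cong (·-identityˡ s) (·-identityˡ t)
    ·-identityˡ (⊖ s)   = ⊖-cong (·-identityˡ s)

  ring⊗ : CRing ℓ
  ring⊗ = toCRing record
    { Carrier = T ; _≈_ = _≈⊗_ ; _+_ = _⊕_ ; _*_ = _·_ ; -_ = ⊖_ ; 0# = 𝟎 ; 1# = A.1# ⊗ B.1#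
    ; isEquivalence = record { refl = ≈refl ; sym = ≈sym ; trans = ≈trans }
    ; +-cong = ⊕-cong
    ; *-cong = λ {s} {s′} {t} {t′} e e′ → ≈trans (·-congˡ t e) (·-congʳ s′ e′)
    ; -‿cong = ⊖-cong
    ; +-assoc = ⊕-assoc
    ; +-comm = ⊕-comm
    ; +-identityˡ = ⊕-identityˡ
    ; -‿inverseˡ = ⊖-inverseˡ
    ; *-assoc = ·-assoc
    ; *-comm = ·-comm
    ; *-identityˡ = ·-identityˡ
    ; distribʳ = λ s t u → ≈refl }

  inclʳ : RingHom B ring⊗
  inclʳ = mkRingHom (λ y → A.1# ⊗ y)
    (⊗-cong A.refl)
    (⊗-distribˡ A.1#)
    (λ y y′ → ⊗-cong (A.sym (A.*-identityˡ A.1#)) B.refl)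
    (λ y → ⊖-unique (≈trans (≈sym (⊗-distribˡ A.1# (B.- y) y))
             (≈trans (⊗-cong A.refl (B.-‿inverseˡ y)) 1⊗0)))
    1⊗0
    ≈refl
    where
    zero-unique : ∀ {s : T} → s ≈⊗ s ⊕ s → s ≈⊗ 𝟎
    zero-unique {s} e = ≈trans (≈sym (⊕-identityˡ s)) (≈trans
      (⊕-cong (≈sym (⊖-inverseˡ s)) ≈refl) (≈trans (⊕-assoc _ s s)
      (≈trans (⊕-cong ≈refl (≈sym e)) (⊖-inverseˡ s))))
    1⊗0 : A.1# ⊗ B.0# ≈⊗ 𝟎
    1⊗0 = zero-unique (≈trans (⊗-cong A.refl (B.sym (B.+-identityˡ B.0#))) (⊗-distribˡ A.1# _ _))

open TensorAlgebra public using (inclʳ) renaming (ring⊗ to _⊗ᴬ_)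

-- Vertices and edges are indexed by Fin.  The orientation of an edge is
-- irrelevant because s u - s v and s v - s u lie in the same ideals.

record EdgeLabeledGraph (R : CRing ℓ) : Set (lsuc ℓ) where
  field
    #vertices #edges : ℕ
    source target    : Fin #edges → Fin #vertices
    label            : Fin #edges → Ideal R

-- The ideal I S of S, written I ⊗ S when S is flat.

data Extension {R S : CRing ℓ} (φ : RingHom R S) (I : Ideal R) :
               Pred (CommutativeRing.Carrier S) ℓ where
  generator : ∀ s {r} → Ideal._∈I I r →
              Extension φ I (CommutativeRing._*_ S s (RingHom.⟦_⟧ φ r))
  ext-0     : Extension φ I (CommutativeRing.0# S)
  ext-+     : ∀ {x y} → Extension φ I x → Extension φ I y →
              Extension φ I (CommutativeRing._+_ S x y)
  ext-≈     : ∀ {x y} → CommutativeRing._≈_ S x y → Extension φ I x → Extension φ I y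

extend : {R S : CRing ℓ} → RingHom R S → Ideal R → Ideal S
extend {S = S} φ I = record
  { _∈I = Extension φ I
  ; ∈-resp-≈ = ext-≈
  ; 0∈ = ext-0
  ; +-closed = ext-+
  ; *-closed = scale }
  where
  open CommutativeRing S
  scale : ∀ t {x} → Extension φ I x → Extension φ I (t * x)
  scale t (generator s r∈) = ext-≈ (*-assoc t s _) (generator (t * s) r∈)
  scale t ext-0            = ext-≈ (sym (zeroʳ t)) ext-0
  scale t (ext-+ p q)      = ext-≈ (sym (distribˡ t _ _)) (ext-+ (scale t p) (scale t q))
  scale t (ext-≈ e p)      = ext-≈ (*-congˡ e) (scale t p)

changeBase : {R S : CRing ℓ} → RingHom R S → EdgeLabeledGraph R → EdgeLabeledGraph S
changeBase φ G = record
  { #vertices = #vertices ; #edges = #edges ; source = source ; target = target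
  ; label = λ e → extend φ (label e) }
  where open EdgeLabeledGraph G

module _ {R : CRing ℓ} (G : EdgeLabeledGraph R) where
  open CommutativeRing R
  open EdgeLabeledGraph G

  record Spline : Set ℓ where
    field
      value    : Fin #vertices → Carrier
      isSpline : ∀ e → Ideal._∈I (label e) (value (source e) - value (target e))
  open Spline

  private
    open RingProperties ring using (-‿distribˡ-*; -‿distribʳ-*; -1*x≈-x)
    open AbelianGroupProperties +-abelianGroup using (⁻¹-∙-comm)
    open SetoidReasoning setoid

    -‿+ : ∀ x y u v → (x - u) + (y - v) ≈ (x + y) - (u + v)
    -‿+ x y u v = begin
      (x - u) + (y - v)        ≈⟨ +-assoc x (- u) (y - v) ⟩
      x + (- u + (y - v))      ≈⟨ +-congˡ (sym (+-assoc (- u) y (- v))) ⟩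
      x + ((- u + y) - v)      ≈⟨ +-congˡ (+-congʳ (+-comm (- u) y)) ⟩
      x + ((y - u) - v)        ≈⟨ +-congˡ (+-assoc y (- u) (- v)) ⟩
      x + (y + (- u - v))      ≈⟨ sym (+-assoc x y _) ⟩
      (x + y) + (- u - v)      ≈⟨ +-congˡ (⁻¹-∙-comm u v) ⟩
      (x + y) - (u + v)        ∎

    -‿* : ∀ x y u v → x * (y - v) + v * (x - u) ≈ x * y - u * v
    -‿* x y u v = begin
      x * (y - v) + v * (x - u)
        ≈⟨ +-cong (distribˡ x y (- v)) (distribˡ v x (- u)) ⟩
      (x * y + x * - v) + (v * x + v * - u)
        ≈⟨ +-cong (+-congˡ (sym (-‿distribʳ-* x v))) (+-cong (*-comm v x) (trans (sym (-‿distribʳ-* v u)) (-‿cong (*-comm v u)))) ⟩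
      (x * y - x * v) + (x * v - u * v)
        ≈⟨ +-assoc (x * y) _ _ ⟩
      x * y + (- (x * v) + (x * v - u * v))
        ≈⟨ +-congˡ (sym (+-assoc _ (x * v) _)) ⟩
      x * y + ((- (x * v) + x * v) - u * v)
        ≈⟨ +-congˡ (trans (+-congʳ (-‿inverseˡ (x * v))) (+-identityˡ _)) ⟩
      x * y - u * v ∎

  constant : Carrier → Spline
  constant r = record
    { value = λ _ → r
    ; isSpline = λ e → let open Ideal (label e) in ∈-resp-≈ (sym (-‿inverseʳ r)) 0∈ }

  splines : CRing ℓ
  splines = toCRing record
    { Carrier = Spline
    ; _≈_ = λ s t → ∀ v → value s v ≈ value t v
    ; _+_ = λ s t → record
      { value = λ v → value s v + value t v
      ; isSpline = λ e → let open Ideal (label e) in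
          ∈-resp-≈ (-‿+ _ _ _ _) (+-closed (isSpline s e) (isSpline t e)) }
    ; _*_ = λ s t → record
      { value = λ v → value s v * value t v
      ; isSpline = λ e → let open Ideal (label e) in
          ∈-resp-≈ (-‿* _ _ _ _) (+-closed (*-closed _ (isSpline t e)) (*-closed _ (isSpline s e))) }
    ; -_ = λ s → record
      { value = λ v → - value s v
      ; isSpline = λ e → let open Ideal (label e) in
          ∈-resp-≈ (trans (-1*x≈-x _) (sym (⁻¹-∙-comm _ _))) (*-closed (- 1#) (isSpline s e)) }
    ; 0# = constant 0#
    ; 1# = constant 1#
    ; isEquivalence = record
      { refl = λ v → refl
      ; sym = λ e v → sym (e v)
      ; trans = λ e e′ v → trans (e v) (e′ v) }
    ; +-cong = λ e e′ v → +-cong (e v) (e′ v)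
    ; *-cong = λ e e′ v → *-cong (e v) (e′ v)
    ; -‿cong = λ e v → -‿cong (e v)
    ; +-assoc = λ s t u v → +-assoc _ _ _
    ; +-comm = λ s t v → +-comm _ _
    ; +-identityˡ = λ s v → +-identityˡ _
    ; -‿inverseˡ = λ s v → -‿inverseˡ _
    ; *-assoc = λ s t u v → *-assoc _ _ _
    ; *-comm = λ s t v → *-comm _ _
    ; *-identityˡ = λ s v → *-identityˡ _
    ; distribʳ = λ s t u v → distribʳ _ _ _ }

  Δ : RingHom R splines
  Δ = mkRingHom constant (λ e _ → e) (λ _ _ _ → refl) (λ _ _ _ → refl) (λ _ _ → refl)
    (λ _ → refl) (λ _ → refl)

-- For a prime p of R, the R_p-algebra (R_G)_p: the localization of R_G
-- at the image of R \ p.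

module _ {R : CRing ℓ} (G : EdgeLabeledGraph R) (p : PrimeIdeal R) where

  splines-at-prime : CRing ℓ
  splines-at-prime = localization (splines G) (image (Δ G) (complement p))

  Δ-at-prime : RingHom (localization R (complement p)) splines-at-prime
  Δ-at-prime = localizeHom (Δ G) (complement p) (image (Δ G) (complement p))
    (λ {x} x∉p → x , x∉p , λ _ → CommutativeRing.refl R)

-- For f in R, the R_f-algebra (R_G)_f: the localization of R_G at the
-- powers of the constant spline f.

module _ {R : CRing ℓ} (G : EdgeLabeledGraph R) (f : CommutativeRing.Carrier R) where
  private
    module R = CommutativeRing R
    module R_G = CommutativeRing (splines G)
    module R^ = Exp R.semiring
    module R_G^ = Exp R_G.semiring

    Δ-^ : ∀ n → constant G (f R^.^ n) R_G.≈ constant G f R_G^.^ n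
    Δ-^ ℕ.zero    v = R.refl
    Δ-^ (ℕ.suc n) v = R.*-congˡ (Δ-^ n v)

  splines-away : CRing ℓ
  splines-away = localization (splines G) (powers (splines G) (constant G f))

  Δ-away : RingHom (localization R (powers R f)) splines-away
  Δ-away = localizeHom (Δ G) (powers R f) (powers (splines G) (constant G f))
    (λ { {x} (n , x≈fⁿ) → n , λ v → R.trans x≈fⁿ (Δ-^ n v) })

record TopologicalSpace (ℓ : Level) : Set (lsuc (lsuc ℓ)) where
  infix 4 _≈_
  field
    Point         : Set (lsuc ℓ)
    _≈_           : Rel Point ℓ
    isEquivalence : IsEquivalence _≈_
    IsOpen        : Pred Point ℓ → Set (lsuc ℓ)
    open-resp-≈   : ∀ {U} → IsOpen U → ∀ {x y} → x ≈ y → U x → U y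
    open-≐        : ∀ {U V} → U ⊆ V → V ⊆ U → IsOpen U → IsOpen V
    open-⊤        : IsOpen (λ _ → ⊤)
    open-∩        : ∀ {U V} → IsOpen U → IsOpen V → IsOpen (U ∩ V)
    open-⋃        : ∀ {I : Set ℓ} (U : I → Pred Point ℓ) → (∀ i → IsOpen (U i)) →
                    IsOpen (λ x → ∃ λ i → U i x)

  open IsEquivalence isEquivalence public

  record Open : Set (lsuc ℓ) where
    constructor opn
    field
      set    : Pred Point ℓ
      isOpen : IsOpen set
  open Open public

  infix 4 _∈ᵒ_ _⊆ᵒ_
  _∈ᵒ_ : Point → Open → Set ℓ
  x ∈ᵒ U = set U x

  _⊆ᵒ_ : Open → Open → Set (lsuc ℓ)
  U ⊆ᵒ V = ∀ {x} → x ∈ᵒ U → x ∈ᵒ V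

  infixr 7 _∩ᵒ_
  _∩ᵒ_ : Open → Open → Open
  U ∩ᵒ V = opn (set U ∩ set V) (open-∩ (isOpen U) (isOpen V))

record Presheaf (T : TopologicalSpace ℓ) : Set (lsuc (lsuc ℓ)) where
  open TopologicalSpace T
  field
    𝓞        : Open → CRing (lsuc ℓ)
    restrict : ∀ {U V} → U ⊆ᵒ V → RingHom (𝓞 V) (𝓞 U)

  module 𝓞 U = CommutativeRing (𝓞 U)

  infixl 8 _∣_
  _∣_ : ∀ {U V} → 𝓞.Carrier V → U ⊆ᵒ V → 𝓞.Carrier U
  _∣_ {U} {V} s i = RingHom.⟦_⟧ (restrict {U} {V} i) s

  field
    restrict-id : ∀ {U} (i : U ⊆ᵒ U) s → 𝓞._≈_ U (_∣_ {U} {U} s i) s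
    restrict-∘  : ∀ {U V W} (i : U ⊆ᵒ V) (j : V ⊆ᵒ W) (k : U ⊆ᵒ W) s →
                  𝓞._≈_ U (_∣_ {U} {V} (_∣_ {V} {W} s j) i) (_∣_ {U} {W} s k)

  record IsSheaf : Set (lsuc (lsuc ℓ)) where
    field
      separated : ∀ {I : Set ℓ} (U : I → Open) (V : Open) (U⊆V : ∀ i → U i ⊆ᵒ V) →
        (∀ {x} → x ∈ᵒ V → ∃ λ i → x ∈ᵒ U i) →
        ∀ s t → (∀ i → 𝓞._≈_ (U i) (_∣_ {U i} {V} s (U⊆V i)) (_∣_ {U i} {V} t (U⊆V i))) →
        𝓞._≈_ V s t
      glue : ∀ {I : Set ℓ} (U : I → Open) (V : Open) (U⊆V : ∀ i → U i ⊆ᵒ V) →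
        (∀ {x} → x ∈ᵒ V → ∃ λ i → x ∈ᵒ U i) →
        (s : ∀ i → 𝓞.Carrier (U i)) →
        (∀ i j → 𝓞._≈_ (U i ∩ᵒ U j) (_∣_ {U i ∩ᵒ U j} {U i} (s i) proj₁)
                                    (_∣_ {U i ∩ᵒ U j} {U j} (s j) proj₂)) →
        ∃ λ t → ∀ i → 𝓞._≈_ (U i) (_∣_ {U i} {V} t (U⊆V i)) (s i)

  -- The germ of s at x is a unit of the stalk.

  record InvertibleAt (x : Point) (U : Open) (s : 𝓞.Carrier U) : Set (lsuc ℓ) where
    field
      nbhd      : Open
      ∈nbhd     : x ∈ᵒ nbhd
      nbhd⊆     : nbhd ⊆ᵒ U
      inverse   : 𝓞.Carrier nbhd
      *-inverse : 𝓞._≈_ nbhd (𝓞._*_ nbhd (_∣_ {nbhd} {U} s nbhd⊆) inverse) (𝓞.1# nbhd)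

  -- Stalks are local rings: 1 ≠ 0, and the sum of two non-units is a
  -- non-unit, both expressed on representatives of germs.

  record HasLocalStalks : Set (lsuc ℓ) where
    field
      nontrivial : ∀ x U → x ∈ᵒ U → ¬ 𝓞._≈_ U (𝓞.1# U) (𝓞.0# U)
      nonunits-+ : ∀ x U → x ∈ᵒ U → ∀ s t → ¬ InvertibleAt x U s → ¬ InvertibleAt x U t →
                   ¬ InvertibleAt x U (𝓞._+_ U s t)

record LocallyRingedSpace (ℓ : Level) : Set (lsuc (lsuc ℓ)) where
  field
    space          : TopologicalSpace ℓ
    presheaf       : Presheaf space
    isSheaf        : Presheaf.IsSheaf presheaf
    hasLocalStalks : Presheaf.HasLocalStalks presheaf
  open TopologicalSpace space public
  open Presheaf presheaf public

record Morphism (X Y : LocallyRingedSpace ℓ) : Set (lsuc (lsuc ℓ)) where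
  private
    module X = LocallyRingedSpace X
    module Y = LocallyRingedSpace Y
  field
    point    : X.Point → Y.Point
    cong     : ∀ {x y} → x X.≈ y → point x Y.≈ point y
    preimage : ∀ {U} → Y.IsOpen U → X.IsOpen (U ∘ point)

  infix 9 _⁻¹
  _⁻¹ : Y.Open → X.Open
  V ⁻¹ = X.opn (Y.set V ∘ point) (preimage (Y.isOpen V))

  field
    pullback : ∀ V → RingHom (Y.𝓞 V) (X.𝓞 (V ⁻¹))

  _♯_ : ∀ V → Y.𝓞.Carrier V → X.𝓞.Carrier (V ⁻¹)
  V ♯ s = RingHom.⟦_⟧ (pullback V) s

  field
    natural : ∀ {U V} (i : U Y.⊆ᵒ V) s →
              X.𝓞._≈_ (U ⁻¹) (X._∣_ {U ⁻¹} {V ⁻¹} (V ♯ s) i) (U ♯ (Y._∣_ {U} {V} s i))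
    local   : ∀ x V → point x Y.∈ᵒ V → ∀ s →
              X.InvertibleAt x (V ⁻¹) (V ♯ s) → Y.InvertibleAt (point x) V s

module _ {X Y : LocallyRingedSpace ℓ} where
  private
    module X = LocallyRingedSpace X
    module Y = LocallyRingedSpace Y

  infix 4 _≈ᵐ_
  record _≈ᵐ_ (f g : Morphism X Y) : Set (lsuc (lsuc ℓ)) where
    private
      module f = Morphism f
      module g = Morphism g
    field
      point≈ : ∀ x → f.point x Y.≈ g.point x

    g⁻¹⊆f⁻¹ : ∀ V → V g.⁻¹ X.⊆ᵒ V f.⁻¹
    g⁻¹⊆f⁻¹ V {x} = Y.open-resp-≈ (Y.isOpen V) (Y.sym (point≈ x))

    field
      pullback≈ : ∀ V s → X.𝓞._≈_ (V g.⁻¹)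
                    (X._∣_ {V g.⁻¹} {V f.⁻¹} (V f.♯ s) (g⁻¹⊆f⁻¹ V)) (V g.♯ s)

idᵐ : {X : LocallyRingedSpace ℓ} → Morphism X X
idᵐ {X = X} = record
  { point = id
  ; cong = id
  ; preimage = id
  ; pullback = λ V → idHom
  ; natural = λ {U} i s → 𝓞.refl U
  ; local = λ x V x∈ s → id }
  where open LocallyRingedSpace X

infixr 9 _∘ᵐ_
_∘ᵐ_ : {X Y Z : LocallyRingedSpace ℓ} → Morphism Y Z → Morphism X Y → Morphism X Z
_∘ᵐ_ {X = X} g f = record
  { point = g.point ∘ f.point
  ; cong = g.cong ∘ f.cong
  ; preimage = f.preimage ∘ g.preimage
  ; pullback = λ V → f.pullback (V g.⁻¹) ∘ʰ g.pullback V
  ; natural = λ {U} {V} i s → 𝓞.trans ((U g.⁻¹) f.⁻¹)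
      (f.natural {U g.⁻¹} {V g.⁻¹} i (V g.♯ s))
      (RingHom.⟦⟧-cong (f.pullback (U g.⁻¹)) (g.natural {U} {V} i s))
  ; local = λ x V x∈ s → g.local (f.point x) V x∈ s ∘ f.local x (V g.⁻¹) x∈ (V g.♯ s) }
  where
  module f = Morphism f
  module g = Morphism g
  open LocallyRingedSpace X

record IsoOver {X Y Z : LocallyRingedSpace ℓ} (f : Morphism X Z) (g : Morphism Y Z) :
               Set (lsuc (lsuc ℓ)) where
  field
    to      : Morphism X Y
    from    : Morphism Y X
    from∘to : from ∘ᵐ to ≈ᵐ idᵐ
    to∘from : to ∘ᵐ from ≈ᵐ idᵐ
    over    : g ∘ᵐ to ≈ᵐ f

module Spectrum (A : CRing ℓ) where
  open CommutativeRing A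
  open PrimeIdeal using (_∈I; _∉I; 1∉; ∉-*; *-∉ˡ; *-∉ʳ)

  -- The Zariski topology: open sets are the unions of basic open sets
  -- D(f) = { p | f ∉ p }.

  zariski : TopologicalSpace ℓ
  zariski = record
    { Point = PrimeIdeal A
    ; _≈_ = λ p q → ∀ x → (_∈I p x → _∈I q x) × (_∈I q x → _∈I p x)
    ; isEquivalence = record
      { refl = λ x → id , id
      ; sym = λ e x → proj₂ (e x) , proj₁ (e x)
      ; trans = λ e e′ x → proj₁ (e′ x) ∘ proj₁ (e x) , proj₂ (e x) ∘ proj₂ (e′ x) }
    ; IsOpen = IsOpen
    ; open-resp-≈ = λ oU {p} {q} p≈q p∈U → let (f , f∉p , D⊆U) = oU p p∈U in
        D⊆U q (f∉p ∘ proj₂ (p≈q f))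
    ; open-≐ = λ U⊆V V⊆U oU p p∈V → let (f , f∉p , D⊆U) = oU p (V⊆U p∈V) in
        f , f∉p , λ q f∉q → U⊆V (D⊆U q f∉q)
    ; open-⊤ = λ p _ → 1# , 1∉ p , λ _ _ → tt
    ; open-∩ = open-∩
    ; open-⋃ = λ U oU p (i , p∈U) → let (f , f∉p , D⊆U) = oU i p p∈U in
        f , f∉p , λ q f∉q → i , D⊆U q f∉q }
    where
    IsOpen : Pred (PrimeIdeal A) _ → Set _
    IsOpen U = ∀ p → U p → ∃ λ f → (_∉I p f) × (∀ q → _∉I q f → U q)

    open-∩ : ∀ {U V} → IsOpen U → IsOpen V → IsOpen (U ∩ V)
    open-∩ oU oV p (p∈U , p∈V) = let (f , f∉p , Df⊆U) = oU p p∈U ; (g , g∉p , Dg⊆V) = oV p p∈V in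
      f * g , ∉-* p f∉p g∉p , λ q fg∉q → Df⊆U q (*-∉ˡ q fg∉q) , Dg⊆V q (*-∉ʳ q fg∉q)

  open TopologicalSpace zariski using (Open; opn; set; _∈ᵒ_; _⊆ᵒ_; _∩ᵒ_)

  basicOpen : Carrier → Open
  basicOpen f = opn (λ p → _∉I p f) (λ p f∉p → f , f∉p , λ _ → id)

  stalk : PrimeIdeal A → CRing ℓ
  stalk p = localization A (complement p)

  module stalk p = CommutativeRing (stalk p)

  -- s agrees with the fraction x/d on a neighbourhood D(g) of p in U.

  record FractionNear (U : Open) (s : ∀ q → q ∈ᵒ U → stalk.Carrier q) (p : PrimeIdeal A) :
                      Set (lsuc ℓ) where
    field
      g x d  : Carrier
      g∉     : _∉I p g
      d∉     : ∀ q → _∉I q g → q ∈ᵒ U → _∉I q d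
      agrees : ∀ q (g∉q : _∉I q g) (q∈ : q ∈ᵒ U) →
               stalk._≈_ q (s q q∈) (frac x d (d∉ q g∉q q∈))

  record Section (U : Open) : Set (lsuc ℓ) where
    field
      value : ∀ p → p ∈ᵒ U → stalk.Carrier p
      near  : ∀ p → p ∈ᵒ U → FractionNear U value p
  open Section
  open FractionNear

  sections : Open → CRing (lsuc ℓ)
  sections U = toCRing record
    { Carrier = Section U
    ; _≈_ = λ s t → ∀ p p∈ → stalk._≈_ p (value s p p∈) (value t p p∈)
    ; _+_ = λ s t → record
      { value = λ p p∈ → stalk._+_ p (value s p p∈) (value t p p∈)
      ; near = λ p p∈ → let m = near s p p∈ ; n = near t p p∈ in record
        { g = g m * g n ; x = x m * d n + x n * d m ; d = d m * d n
        ; g∉ = ∉-* p (g∉ m) (g∉ n)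
        ; d∉ = λ q g∉q q∈ → ∉-* q (d∉ m q (*-∉ˡ q g∉q) q∈) (d∉ n q (*-∉ʳ q g∉q) q∈)
        ; agrees = λ q g∉q q∈ → stalk.+-cong q (agrees m q (*-∉ˡ q g∉q) q∈) (agrees n q (*-∉ʳ q g∉q) q∈) } }
    ; _*_ = λ s t → record
      { value = λ p p∈ → stalk._*_ p (value s p p∈) (value t p p∈)
      ; near = λ p p∈ → let m = near s p p∈ ; n = near t p p∈ in record
        { g = g m * g n ; x = x m * x n ; d = d m * d n
        ; g∉ = ∉-* p (g∉ m) (g∉ n)
        ; d∉ = λ q g∉q q∈ → ∉-* q (d∉ m q (*-∉ˡ q g∉q) q∈) (d∉ n q (*-∉ʳ q g∉q) q∈)
        ; agrees = λ q g∉q q∈ → stalk.*-cong q (agrees m q (*-∉ˡ q g∉q) q∈) (agrees n q (*-∉ʳ q g∉q) q∈) } }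
    ; -_ = λ s → record
      { value = λ p p∈ → stalk.-_ p (value s p p∈)
      ; near = λ p p∈ → let m = near s p p∈ in record
        { g = g m ; x = - x m ; d = d m ; g∉ = g∉ m ; d∉ = d∉ m
        ; agrees = λ q g∉q q∈ → stalk.-‿cong q (agrees m q g∉q q∈) } }
    ; 0# = global 0#
    ; 1# = global 1#
    ; isEquivalence = record
      { refl = λ p _ → stalk.refl p
      ; sym = λ e p p∈ → stalk.sym p (e p p∈)
      ; trans = λ e e′ p p∈ → stalk.trans p (e p p∈) (e′ p p∈) }
    ; +-cong = λ e e′ p p∈ → stalk.+-cong p (e p p∈) (e′ p p∈)
    ; *-cong = λ e e′ p p∈ → stalk.*-cong p (e p p∈) (e′ p p∈)
    ; -‿cong = λ e p p∈ → stalk.-‿cong p (e p p∈)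
    ; +-assoc = λ s t u p p∈ → stalk.+-assoc p (value s p p∈) (value t p p∈) (value u p p∈)
    ; +-comm = λ s t p p∈ → stalk.+-comm p (value s p p∈) (value t p p∈)
    ; +-identityˡ = λ s p p∈ → stalk.+-identityˡ p (value s p p∈)
    ; -‿inverseˡ = λ s p p∈ → stalk.-‿inverseˡ p (value s p p∈)
    ; *-assoc = λ s t u p p∈ → stalk.*-assoc p (value s p p∈) (value t p p∈) (value u p p∈)
    ; *-comm = λ s t p p∈ → stalk.*-comm p (value s p p∈) (value t p p∈)
    ; *-identityˡ = λ s p p∈ → stalk.*-identityˡ p (value s p p∈)
    ; distribʳ = λ s t u p p∈ → stalk.distribʳ p (value s p p∈) (value t p p∈) (value u p p∈) }
    where
    global : Carrier → Section U
    global x = record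
      { value = λ p _ → frac x 1# (1∉ p)
      ; near = λ p _ → record
        { g = 1# ; x = x ; d = 1# ; g∉ = 1∉ p ; d∉ = λ q _ _ → 1∉ q
        ; agrees = λ q _ _ → stalk.refl q } }

  restriction : ∀ {U V} → U ⊆ᵒ V → RingHom (sections V) (sections U)
  restriction {U} {V} U⊆V = mkRingHom
    (λ s → record
      { value = λ p p∈ → value s p (U⊆V p∈)
      ; near = λ p p∈ → let m = near s p (U⊆V p∈) in record
        { g = g m ; x = x m ; d = d m ; g∉ = g∉ m
        ; d∉ = λ q g∉q q∈ → d∉ m q g∉q (U⊆V q∈)
        ; agrees = λ q g∉q q∈ → agrees m q g∉q (U⊆V q∈) } })
    (λ e p p∈ → e p (U⊆V p∈))
    (λ _ _ p _ → stalk.refl p) (λ _ _ p _ → stalk.refl p) (λ _ p _ → stalk.refl p)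
    (λ p _ → stalk.refl p) (λ p _ → stalk.refl p)

  frac-irrelevant : ∀ p {x d} (h h′ : _∉I p d) → stalk._≈_ p (frac x d h) (frac x d h′)
  frac-irrelevant p h h′ = Localize.≈⇒~ A (complement p) refl

  value-irrelevant : ∀ {U} (s : Section U) p (h h′ : p ∈ᵒ U) →
                     stalk._≈_ p (value s p h) (value s p h′)
  value-irrelevant s p h h′ = let m = near s p h in
    stalk.trans p (agrees m p (g∉ m) h) (stalk.trans p (frac-irrelevant p _ _)
      (stalk.sym p (agrees m p (g∉ m) h′)))

  unit⇒num∉ : ∀ p (F G : stalk.Carrier p) → stalk._≈_ p (stalk._*_ p F G) (stalk.1# p) → _∉I p (num F)
  unit⇒num∉ p F G (Localize.via u u∉ e) = *-∉ˡ p (*-∉ˡ p (*-∉ʳ p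
    (λ ∈p → ∉-* p u∉ (∉-* p (1∉ p) (∉-* p (den∈ F) (den∈ G)))
      (PrimeIdeal.∈-resp-≈ p e ∈p))))

  structurePresheaf : Presheaf zariski
  structurePresheaf = record
    { 𝓞 = sections
    ; restrict = λ {U} {V} → restriction {U} {V}
    ; restrict-id = λ i s p p∈ → value-irrelevant s p _ _
    ; restrict-∘ = λ i j k s p p∈ → value-irrelevant s p _ _ }

  open Presheaf structurePresheaf using (IsSheaf; HasLocalStalks; InvertibleAt)
  open InvertibleAt

  structureIsSheaf : IsSheaf
  structureIsSheaf = record
    { separated = λ U V U⊆V cover s t s≈t p p∈V → let (i , p∈Ui) = cover p∈V in
        stalk.trans p (value-irrelevant s p _ _)
          (stalk.trans p (s≈t i p p∈Ui) (value-irrelevant t p _ _))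
    ; glue = λ U V U⊆V cover s agree →
        let same : ∀ i j p (h : p ∈ᵒ U i) (k : p ∈ᵒ U j) → stalk._≈_ p (value (s i) p h) (value (s j) p k)
            same i j p h k = agree i j p (h , k)
        in record
          { value = λ p p∈V → let (i , p∈Ui) = cover p∈V in value (s i) p p∈Ui
          ; near = λ p p∈V →
              let (i , p∈Ui) = cover p∈V
                  m = near (s i) p p∈Ui
                  (f , f∉p , Df⊆Ui) = Open.isOpen (U i) p p∈Ui
              in record
                { g = f * g m ; x = x m ; d = d m
                ; g∉ = ∉-* p f∉p (g∉ m)
                ; d∉ = λ q fg∉q _ → d∉ m q (*-∉ʳ q fg∉q) (Df⊆Ui q (*-∉ˡ q fg∉q))
                ; agrees = λ q fg∉q q∈V → let (j , q∈Uj) = cover q∈V in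
                    stalk.trans q (same j i q q∈Uj (Df⊆Ui q (*-∉ˡ q fg∉q)))
                      (agrees m q (*-∉ʳ q fg∉q) (Df⊆Ui q (*-∉ˡ q fg∉q))) } }
          , λ i p p∈Ui → same (proj₁ (cover (U⊆V i p∈Ui))) i p _ p∈Ui }

  num∉⇒invertible : ∀ p U (s : Section U) (p∈ : p ∈ᵒ U) →
                    _∉I p (x (near s p p∈)) → InvertibleAt p U s
  num∉⇒invertible p U s p∈ x∉ = record
    { nbhd = U ∩ᵒ basicOpen (g m * x m)
    ; ∈nbhd = p∈ , ∉-* p (g∉ m) x∉
    ; nbhd⊆ = proj₁
    ; inverse = record
      { value = λ q q∈ → frac (d m) (x m) (*-∉ʳ q (proj₂ q∈))
      ; near = λ q q∈ → record
        { g = 1# ; x = d m ; d = x m ; g∉ = 1∉ q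
        ; d∉ = λ r _ r∈ → *-∉ʳ r (proj₂ r∈)
        ; agrees = λ r _ r∈ → stalk.refl r } }
    ; *-inverse = λ q q∈ → stalk.trans q
        (stalk.*-congʳ q {frac (d m) (x m) (*-∉ʳ q (proj₂ q∈))}
          (agrees m q (*-∉ˡ q (proj₂ q∈)) (proj₁ q∈)))
        (Localize.≈⇒~ A (complement q) (trans (*-identityʳ _) (trans (*-comm _ _) (sym (*-identityˡ _))))) }
    where m = near s p p∈

  invertible⇒num∉ : ∀ p U (s : Section U) (p∈ : p ∈ᵒ U) → InvertibleAt p U s →
                    ∀ F → stalk._≈_ p (value s p p∈) F → _∉I p (num F)
  invertible⇒num∉ p U s p∈ inv F s≈F = unit⇒num∉ p F t
    (stalk.trans p (stalk.*-congʳ p {t} (stalk.trans p (stalk.sym p s≈F) (value-irrelevant s p _ _)))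
      (*-inverse inv p (∈nbhd inv)))
    where t = value (inverse inv) p (∈nbhd inv)

  structureHasLocalStalks : HasLocalStalks
  structureHasLocalStalks = record
    { nontrivial = λ p U p∈ 1≈0 → unit⇒num∉ p (stalk.0# p) (stalk.1# p)
        (stalk.trans p (stalk.*-identityʳ p _) (stalk.sym p (1≈0 p p∈))) (PrimeIdeal.0∈ p)
    ; nonunits-+ = λ p U p∈ s t ¬s ¬t s+t →
        let m = near s p p∈ ; n = near t p p∈ in
        ¬s (num∉⇒invertible p U s p∈ λ x∈ →
        ¬t (num∉⇒invertible p U t p∈ λ y∈ →
        invertible⇒num∉ p U (CommutativeRing._+_ (sections U) s t) p∈ s+t
          (stalk._+_ p (frac (x m) (d m) (d∉ m p (g∉ m) p∈)) (frac (x n) (d n) (d∉ n p (g∉ n) p∈)))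
          (stalk.+-cong p (agrees m p (g∉ m) p∈) (agrees n p (g∉ n) p∈))
          (PrimeIdeal.+-closed p (∈-*ʳ p x∈) (∈-*ʳ p y∈)))) }
    where
    ∈-*ʳ : ∀ p {x y} → _∈I p x → _∈I p (x * y)
    ∈-*ʳ p {x} {y} x∈ = PrimeIdeal.∈-resp-≈ p (*-comm y x) (PrimeIdeal.*-closed p y x∈)

  Spec : LocallyRingedSpace ℓ
  Spec = record
    { space = zariski
    ; presheaf = structurePresheaf
    ; isSheaf = structureIsSheaf
    ; hasLocalStalks = structureHasLocalStalks }

open Spectrum public using (Spec)

contract : {A B : CRing ℓ} → RingHom A B → PrimeIdeal B → PrimeIdeal A
contract {B = B} φ q = record
  { ideal = record
    { _∈I = λ x → φ.⟦ x ⟧ ∈I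
    ; ∈-resp-≈ = ∈-resp-≈ ∘ φ.⟦⟧-cong
    ; 0∈ = ∈-resp-≈ (sym φ.0#-homo) 0∈
    ; +-closed = λ x∈ y∈ → ∈-resp-≈ (sym (φ.+-homo _ _)) (+-closed x∈ y∈)
    ; *-closed = λ r x∈ → ∈-resp-≈ (sym (φ.*-homo r _)) (*-closed φ.⟦ r ⟧ x∈) }
  ; 1∉ = 1∉ ∘ ∈-resp-≈ φ.1#-homo
  ; prime = λ x y xy∈ → prime _ _ (∈-resp-≈ (φ.*-homo x y) xy∈) }
  where
  module φ = RingHom φ
  open PrimeIdeal q
  open CommutativeRing B using (sym)

stalkHom : {A B : CRing ℓ} (φ : RingHom A B) (q : PrimeIdeal B) →
           RingHom (Spectrum.stalk A (contract φ q)) (Spectrum.stalk B q)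
stalkHom φ q = localizeHom φ (complement (contract φ q)) (complement q) (λ x∉ → x∉)

Spec-map : {A B : CRing ℓ} → RingHom A B → Morphism (Spec B) (Spec A)
Spec-map {A = A} {B} φ = record
  { point = contract φ
  ; cong = λ e x → e φ.⟦ x ⟧
  ; preimage = preimage
  ; pullback = λ V → mkRingHom (pull V)
      (λ e q q∈ → φ̂.⟦⟧-cong q (e (contract φ q) q∈))
      (λ s t q q∈ → φ̂.+-homo q (Section.value s (contract φ q) q∈) (Section.value t (contract φ q) q∈))
      (λ s t q q∈ → φ̂.*-homo q (Section.value s (contract φ q) q∈) (Section.value t (contract φ q) q∈))
      (λ s q q∈ → φ̂.-‿homo q (Section.value s (contract φ q) q∈))
      (λ q q∈ → φ̂.0#-homo q)
      (λ q q∈ → φ̂.1#-homo q)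
  ; natural = λ i s q q∈ → B.stalk.refl q
  ; local = λ q V q∈ s inv →
      let m = Section.near s (contract φ q) q∈ in
      A.num∉⇒invertible (contract φ q) V s q∈
        (B.invertible⇒num∉ q _ (pull V s) q∈ inv (φ̂.⟦_⟧ q (frac (x m) (d m) _))
          (φ̂.⟦⟧-cong q (agrees m (contract φ q) (g∉ m) q∈))) }
  where
  module φ = RingHom φ
  module φ̂ q = RingHom (stalkHom φ q)
  module A = Spectrum A
  module B = Spectrum B
  open A using (Section; module FractionNear)
  open FractionNear
  open TopologicalSpace A.zariski using (IsOpen)

  preimage : ∀ {U} → IsOpen U → TopologicalSpace.IsOpen B.zariski (U ∘ contract φ)
  preimage oU q q∈ = let (f , f∉ , Df⊆U) = oU (contract φ q) q∈ in
    φ.⟦ f ⟧ , f∉ , λ r φf∉r → Df⊆U (contract φ r) φf∉r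

  pull : ∀ V → Section V → B.Section (TopologicalSpace.opn _ (preimage (TopologicalSpace.isOpen V)))
  pull V s = record
    { value = λ q q∈ → φ̂.⟦_⟧ q (Section.value s (contract φ q) q∈)
    ; near = λ q q∈ → let m = Section.near s (contract φ q) q∈ in record
      { g = φ.⟦ g m ⟧ ; x = φ.⟦ x m ⟧ ; d = φ.⟦ d m ⟧
      ; g∉ = g∉ m
      ; d∉ = λ r g∉r r∈ → d∉ m (contract φ r) g∉r r∈
      ; agrees = λ r g∉r r∈ → φ̂.⟦⟧-cong r (agrees m (contract φ r) g∉r r∈) } }

splineStructureMorphism : {R : CRing ℓ} (G : EdgeLabeledGraph R) →
                          Morphism (Spec (splines G)) (Spec R)
splineStructureMorphism G = Spec-map (Δ G)

-- The fibre product of Spec A and Spec S over Spec R is Spec (A ⊗ S), so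
-- this is the base change of Spec-map α along Spec-map φ.

baseChange : {R A S : CRing ℓ} (α : RingHom R A) (φ : RingHom R S) →
             Morphism (Spec (α ⊗ᴬ φ)) (Spec S)
baseChange α φ = Spec-map (inclʳ α φ)

{-# OPTIONS --safe #-}

-- R_G is the kernel of the composite Rⱽ → Rᴱ → ∏ R/I_e, x ↦ x u - x v, so Rⱽ/R_G
-- embeds in ∏ R/I_e.  Flatness keeps both R_G → Rⱽ and this embedding injective
-- after - ⊗ S.  The first makes R_G ⊗ S → S_{F_S(G)} injective.  For surjectivity,
-- the element ∑ δ_v ⊗ t_v of (Rⱽ/R_G) ⊗ S attached to a spline t over S maps to
-- ∑ δ_e ⊗ (t u - t v) in (∏ R/I_e) ⊗ S, which vanishes since t u - t v ∈ I_e S;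
-- hence it already vanishes in (Rⱽ/R_G) ⊗ S, and t comes from R_G ⊗ S.
-- For localizations, a spline over R[M⁻¹] has finitely many denominators, and
-- finitely many edge conditions, to clear.

module Submission where

open import Defs
open import Algebra.Bundles using (AbelianGroup; CommutativeRing)
open import Algebra.Module.Bundles using (LeftModule)
open import Algebra.Module.Morphism.Structures using (module LeftModuleMorphisms)
open import Algebra.Morphism.Structures using (module RingMorphisms)
import Algebra.Properties.AbelianGroup as AbelianGroupProperties
import Algebra.Properties.CommutativeMonoid.Sum as MonoidSum
import Algebra.Properties.CommutativeSemigroup as CommutativeSemigroupProperties
import Algebra.Properties.Ring as RingProperties
import Algebra.Properties.Semiring.Exp as Exp
import Algebra.Properties.Semiring.Sum as SemiringSum
import Algebra.Solver.Ring.NaturalCoefficients.Default as Solver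
open import Data.Fin.Base using (Fin; zero; suc)
open import Data.Nat.Base as ℕ using (ℕ)
open import Data.Product.Base using (∃; ∃₂; _×_; _,_; proj₁; proj₂)
open import Function.Base using (_∘_)
open import Level using (Level) renaming (suc to lsuc)
import Relation.Binary.Reasoning.Setoid as SetoidReasoning
open import Relation.Unary using (Pred)

open Fraction

private
  variable
    ℓ : Level

-- Differences in abelian groups and Kronecker deltas.

module Differences {c ℓ} (G : AbelianGroup c ℓ) where
  open AbelianGroup G
  open AbelianGroupProperties G using (⁻¹-∙-comm)
  open CommutativeSemigroupProperties commutativeSemigroup using (interchange)

  -‿∙-interchange : ∀ a b c d → (a ∙ b) - (c ∙ d) ≈ (a - c) ∙ (b - d)
  -‿∙-interchange a b c d =
    trans (∙-congˡ (sym (⁻¹-∙-comm c d))) (interchange a b (c ⁻¹) (d ⁻¹))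

  -‿-‿interchange : ∀ a b c d → (a - b) - (c - d) ≈ (a - c) - (b - d)
  -‿-‿interchange a b c d =
    trans (-‿∙-interchange a (b ⁻¹) c (d ⁻¹)) (∙-congˡ (⁻¹-∙-comm b (d ⁻¹)))

  -‿telescope : ∀ a b c → (a - b) ∙ (b - c) ≈ a - c
  -‿telescope a b c = trans (assoc a (b ⁻¹) (b - c)) (∙-congˡ
    (trans (sym (assoc (b ⁻¹) b (c ⁻¹))) (trans (∙-congʳ (inverseˡ b)) (identityˡ (c ⁻¹)))))

module Kronecker (A : CRing ℓ) where
  open CommutativeRing A hiding (zero)
  open SemiringSum semiring using (sum; sum-cong-≋; sum-replicate-zero)

  δ : ∀ {n} → Fin n → Fin n → Carrier
  δ zero    zero    = 1#
  δ zero    (suc j) = 0#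
  δ (suc i) zero    = 0#
  δ (suc i) (suc j) = δ i j

  sum-δ : ∀ {n} (a : Fin n → Carrier) j → sum (λ i → a i * δ i j) ≈ a j
  sum-δ {ℕ.suc n} a zero = trans
    (+-cong (*-identityʳ (a zero))
      (trans (sum-cong-≋ {n} (λ i → zeroʳ (a (suc i)))) (sum-replicate-zero n)))
    (+-identityʳ (a zero))
  sum-δ a (suc j) = trans (+-cong (zeroʳ (a zero)) (sum-δ (a ∘ suc) j)) (+-identityˡ (a (suc j)))

-- Quotients of finite free modules.

record Submodule (R : CRing ℓ) (n : ℕ) : Set (lsuc ℓ) where
  open CommutativeRing R
  infix 4 _∈K
  field
    _∈K      : Pred (Fin n → Carrier) ℓ
    ∈-resp-≈ : ∀ {x y} → (∀ i → x i ≈ y i) → x ∈K → y ∈K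
    0∈       : (λ _ → 0#) ∈K
    +-closed : ∀ {x y} → x ∈K → y ∈K → (λ i → x i + y i) ∈K
    *-closed : ∀ r {x} → x ∈K → (λ i → r * x i) ∈K

module Quotient {R : CRing ℓ} {n : ℕ} (K : Submodule R n) where
  open CommutativeRing R
  open Submodule K
  open RingProperties ring using (-1*x≈-x; x[y-z]≈xy-xz)
  open AbelianGroupProperties +-abelianGroup using (⁻¹-∙-comm; ⁻¹-anti-homo‿-; x≈y⇒x∙y⁻¹≈ε)
  open Differences +-abelianGroup

  -‿closed : ∀ {x} → x ∈K → (λ i → - x i) ∈K
  -‿closed x∈ = ∈-resp-≈ (λ i → -1*x≈-x _) (*-closed (- 1#) x∈)

  infix 4 _≈ᴷ_
  _≈ᴷ_ : (x y : Fin n → Carrier) → Set _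
  x ≈ᴷ y = (λ i → x i - y i) ∈K

  ≋⇒≈ᴷ : ∀ {x y} → (∀ i → x i ≈ y i) → x ≈ᴷ y
  ≋⇒≈ᴷ e = ∈-resp-≈ (λ i → sym (x≈y⇒x∙y⁻¹≈ε (e i))) 0∈

  -- The carrier stays Rⁿ and only the equality is coarsened, so a map out of Rⁿ/K is given on
  -- representatives and its well-definedness is a membership statement.
  quotient : RModule R
  quotient = record
    { Carrierᴹ = Fin n → Carrier
    ; _≈ᴹ_ = _≈ᴷ_
    ; _+ᴹ_ = λ x y i → x i + y i
    ; _*ₗ_ = λ r x i → r * x i
    ; 0ᴹ = λ _ → 0#
    ; -ᴹ_ = λ x i → - x i
    ; isLeftModule = record
      { isLeftSemimodule = record
        { +ᴹ-isCommutativeMonoid = record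
          { isMonoid = record
            { isSemigroup = record
              { isMagma = record
                { isEquivalence = record
                  { refl = ≋⇒≈ᴷ (λ _ → refl)
                  ; sym = λ e → ∈-resp-≈ (λ i → ⁻¹-anti-homo‿- _ _) (-‿closed e)
                  ; trans = ≈ᴷ-trans }
                ; ∙-cong = λ e e′ → ∈-resp-≈ (λ i → sym (-‿∙-interchange _ _ _ _)) (+-closed e e′) }
              ; assoc = λ x y z → ≋⇒≈ᴷ (λ i → +-assoc _ _ _) }
            ; identity = (λ x → ≋⇒≈ᴷ (λ i → +-identityˡ _)) , λ x → ≋⇒≈ᴷ (λ i → +-identityʳ _) }
          ; comm = λ x y → ≋⇒≈ᴷ (λ i → +-comm _ _) }
        ; isPreleftSemimodule = record
          { *ₗ-cong = λ {r} {s} {x} {y} r≈s e → ≈ᴷ-trans {y = λ i → s * x i}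
              (≋⇒≈ᴷ (λ i → *-congʳ r≈s))
              (∈-resp-≈ (λ i → x[y-z]≈xy-xz s _ _) (*-closed s e))
          ; *ₗ-zeroˡ = λ x → ≋⇒≈ᴷ (λ i → zeroˡ _)
          ; *ₗ-distribʳ = λ x r s → ≋⇒≈ᴷ (λ i → distribʳ _ _ _)
          ; *ₗ-identityˡ = λ x → ≋⇒≈ᴷ (λ i → *-identityˡ _)
          ; *ₗ-assoc = λ r s x → ≋⇒≈ᴷ (λ i → *-assoc _ _ _)
          ; *ₗ-zeroʳ = λ r → ≋⇒≈ᴷ (λ i → zeroʳ _)
          ; *ₗ-distribˡ = λ r x y → ≋⇒≈ᴷ (λ i → distribˡ _ _ _) } }
      ; -ᴹ‿cong = λ e → ∈-resp-≈ (λ i → sym (⁻¹-∙-comm _ _)) (-‿closed e)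
      ; -ᴹ‿inverse = (λ x → ≋⇒≈ᴷ (λ i → -‿inverseˡ _)) , λ x → ≋⇒≈ᴷ (λ i → -‿inverseʳ _) } }
    where
    ≈ᴷ-trans : ∀ {x y z} → x ≈ᴷ y → y ≈ᴷ z → x ≈ᴷ z
    ≈ᴷ-trans e e′ = ∈-resp-≈ (λ i → -‿telescope _ _ _) (+-closed e e′)

open Quotient using (quotient)

-- Tensor products of Rⁿ/K with S in coordinates.

module TensorProperties {R : CRing ℓ} (M N : RModule R) where
  private
    module M = LeftModule M
    module N = LeftModule N
    module ΣM = MonoidSum M.+ᴹ-commutativeMonoid

  tensorAbelianGroup : AbelianGroup ℓ ℓ
  tensorAbelianGroup = record
    { Carrier = Tensor R M N ; _≈_ = _≈⊗_ ; _∙_ = _⊕_ ; ε = 𝟎 ; _⁻¹ = ⊖_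
    ; isAbelianGroup = record
      { isGroup = record
        { isMonoid = record
          { isSemigroup = record
            { isMagma = record
              { isEquivalence = record { refl = ≈refl ; sym = ≈sym ; trans = ≈trans }
              ; ∙-cong = ⊕-cong }
            ; assoc = ⊕-assoc }
          ; identity = ⊕-identityˡ , λ s → ≈trans (⊕-comm s 𝟎) (⊕-identityˡ s) }
        ; inverse = ⊖-inverseˡ , λ s → ≈trans (⊕-comm s (⊖ s)) (⊖-inverseˡ s)
        ; ⁻¹-cong = ⊖-cong }
      ; comm = ⊕-comm } }

  open AbelianGroup tensorAbelianGroup using (commutativeMonoid)
  open AbelianGroupProperties tensorAbelianGroup using (identityˡ-unique; inverseˡ-unique)
  open MonoidSum commutativeMonoid using (sum)

  ⊗-zeroˡ : ∀ y → M.0ᴹ ⊗ y ≈⊗ 𝟎 {R = R} {M} {N}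
  ⊗-zeroˡ y = identityˡ-unique _ _
    (≈trans (≈sym (⊗-distribʳ _ _ _)) (⊗-cong (M.+ᴹ-identityˡ M.0ᴹ) N.≈ᴹ-refl))

  ⊗-zeroʳ : ∀ x → x ⊗ N.0ᴹ ≈⊗ 𝟎 {R = R} {M} {N}
  ⊗-zeroʳ x = identityˡ-unique _ _
    (≈trans (≈sym (⊗-distribˡ _ _ _)) (⊗-cong M.≈ᴹ-refl (N.+ᴹ-identityˡ N.0ᴹ)))

  sum-⊗ : ∀ {n} (x : Fin n → M.Carrierᴹ) y → ΣM.sum x ⊗ y ≈⊗ sum (λ i → x i ⊗ y)
  sum-⊗ {ℕ.zero}  x y = ⊗-zeroˡ y
  sum-⊗ {ℕ.suc n} x y = ≈trans (⊗-distribʳ _ _ _) (⊕-cong ≈refl (sum-⊗ (x ∘ suc) y))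

module Coordinates {R S : CRing ℓ} (φ : RingHom R S) {n : ℕ} (K : Submodule R n) where
  private
    module R = CommutativeRing R
    module S = CommutativeRing S
    module φ = RingHom φ
    Rⁿ/K = quotient K
    module Rⁿ/K = LeftModule Rⁿ/K
    module δR = Kronecker R
    module δS = Kronecker S
    module ΣR = SemiringSum R.semiring
    module ΣS = SemiringSum S.semiring
    module ΣK = MonoidSum Rⁿ/K.+ᴹ-commutativeMonoid
  open Kronecker R using (δ)
  open Quotient K using (≋⇒≈ᴷ)
  open TensorProperties {R = R} Rⁿ/K (asModule φ)
  open AbelianGroup tensorAbelianGroup using (commutativeMonoid)
  open AbelianGroupProperties tensorAbelianGroup using (inverseˡ-unique)
  open MonoidSum commutativeMonoid using (sum; sum-cong-≋; sum-replicate-zero; ∑-distrib-+)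

  T : Set ℓ
  T = Tensor R Rⁿ/K (asModule φ)

  -- A function of formal terms, not of tensor classes: `⊗-cong` may change `x` by an element of
  -- `K`, and the coordinates then change as well.
  coords : T → Fin n → S.Carrier
  coords (x ⊗ y) i = φ.⟦ x i ⟧ S.* y
  coords 𝟎       i = S.0#
  coords (s ⊕ t) i = coords s i S.+ coords t i
  coords (⊖ s)   i = S.- coords s i

  combine : (Fin n → S.Carrier) → T
  combine c = sum (λ i → δ i ⊗ c i)

  combine-cong : ∀ {c d} → (∀ i → c i S.≈ d i) → combine c ≈⊗ combine d
  combine-cong e = sum-cong-≋ {n} (λ i → ⊗-cong Rⁿ/K.≈ᴹ-refl (e i))

  combine-+ : ∀ c d → combine (λ i → c i S.+ d i) ≈⊗ combine c ⊕ combine d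
  combine-+ c d = ≈trans (sum-cong-≋ {n} (λ i → ⊗-distribˡ (δ i) (c i) (d i)))
    (∑-distrib-+ {n} (λ i → δ i ⊗ c i) (λ i → δ i ⊗ d i))

  combine-≈𝟎 : ∀ c → (∀ i → δ i ⊗ c i ≈⊗ 𝟎 {R = R} {Rⁿ/K} {asModule φ}) → combine c ≈⊗ 𝟎
  combine-≈𝟎 c e = ≈trans (sum-cong-≋ {n} e) (sum-replicate-zero n)

  combine-0 : combine (λ _ → S.0#) ≈⊗ 𝟎
  combine-0 = combine-≈𝟎 _ (λ i → ⊗-zeroʳ (δ i))

  combine-neg : ∀ c → combine (λ i → S.- c i) ≈⊗ ⊖ combine c
  combine-neg c = inverseˡ-unique _ _ (≈trans (≈sym (combine-+ (λ i → S.- c i) c))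
    (≈trans (combine-cong (λ i → S.-‿inverseˡ (c i))) combine-0))

  ΣK≈ΣR : ∀ m (x : Fin m → Fin n → R.Carrier) j → ΣK.sum x j R.≈ ΣR.sum (λ i → x i j)
  ΣK≈ΣR ℕ.zero    x j = R.refl
  ΣK≈ΣR (ℕ.suc m) x j = R.+-congˡ (ΣK≈ΣR m (x ∘ suc) j)

  -- Writing x as the sum of the xᵢ δᵢ and moving each xᵢ across the tensor sign gives the case of a
  -- pure tensor; the rest is additivity. Terms with equal coordinates are therefore equal in the
  -- tensor product.
  decompose : ∀ t → t ≈⊗ combine (coords t)
  decompose (x ⊗ y) = ≈trans
    (⊗-cong (≋⇒≈ᴷ (λ j → R.sym (R.trans (ΣK≈ΣR n _ j) (δR.sum-δ x j)))) S.refl)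
    (≈trans (sum-⊗ {n} (λ i → x i Rⁿ/K.*ₗ δ i) y)
      (sum-cong-≋ {n} (λ i → ⊗-balanced (x i) (δ i) y)))
  decompose 𝟎       = ≈sym combine-0
  decompose (s ⊕ t) = ≈trans (⊕-cong (decompose s) (decompose t)) (≈sym (combine-+ _ _))
  decompose (⊖ s)   = ≈trans (⊖-cong (decompose s)) (≈sym (combine-neg _))

  φ-δ : ∀ {m} (i j : Fin m) → φ.⟦ δR.δ i j ⟧ S.≈ δS.δ i j
  φ-δ zero    zero    = φ.1#-homo
  φ-δ zero    (suc j) = φ.0#-homo
  φ-δ (suc i) zero    = φ.0#-homo
  φ-δ (suc i) (suc j) = φ-δ i j

  coords-sum : ∀ m (t : Fin m → T) j → coords (sum t) j S.≈ ΣS.sum (λ i → coords (t i) j)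
  coords-sum ℕ.zero    t j = S.refl
  coords-sum (ℕ.suc m) t j = S.+-congˡ (coords-sum m (t ∘ suc) j)

  coords-combine : ∀ c j → coords (combine c) j S.≈ c j
  coords-combine c j = S.trans (coords-sum n _ j)
    (S.trans (ΣS.sum-cong-≋ {n} (λ i → S.trans (S.*-congʳ (φ-δ i j)) (S.*-comm _ _)))
      (δS.sum-δ c j))

-- The universal property of the tensor product of algebras.

module _ {R A B C : CRing ℓ} {α : RingHom R A} {β : RingHom R B}
         (f : RingHom A C) (g : RingHom B C) where
  private
    module A = CommutativeRing A
    module B = CommutativeRing B
    module f = RingHom f
    module g = RingHom g
    module α = RingHom α
    module β = RingHom β
  open CommutativeRing C
  open RingProperties ring using (-‿distribˡ-*; -‿distribʳ-*)
  open CommutativeSemigroupProperties *-commutativeSemigroup using (interchange)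
  open TensorAlgebra α β using (T; scale; _·_)

  private
    lift : T → Carrier
    lift (x ⊗ y) = f.⟦ x ⟧ * g.⟦ y ⟧
    lift 𝟎       = 0#
    lift (s ⊕ t) = lift s + lift t
    lift (⊖ s)   = - lift s

    lift-scale : ∀ x y t → lift (scale x y t) ≈ (f.⟦ x ⟧ * g.⟦ y ⟧) * lift t
    lift-scale x y (x′ ⊗ y′) =
      trans (*-cong (f.*-homo x x′) (g.*-homo y y′)) (interchange _ _ _ _)
    lift-scale x y 𝟎       = sym (zeroʳ _)
    lift-scale x y (s ⊕ t) = trans (+-cong (lift-scale x y s) (lift-scale x y t)) (sym (distribˡ _ _ _))
    lift-scale x y (⊖ s)   = trans (-‿cong (lift-scale x y s)) (-‿distribʳ-* _ _)

    lift-· : ∀ s t → lift (s · t) ≈ lift s * lift t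
    lift-· (x ⊗ y) t = lift-scale x y t
    lift-· 𝟎       t = sym (zeroˡ _)
    lift-· (s ⊕ u) t = trans (+-cong (lift-· s t) (lift-· u t)) (sym (distribʳ _ _ _))
    lift-· (⊖ s)   t = trans (-‿cong (lift-· s t)) (-‿distribˡ-* _ _)

  -- Agreement of `f` and `g` on `R` is what makes the formal lift respect `⊗-balanced`; the other
  -- relations follow from the homomorphism laws and the ring axioms.
  ⊗-lift : (∀ r → f.⟦ α.⟦ r ⟧ ⟧ ≈ g.⟦ β.⟦ r ⟧ ⟧) → RingHom (α ⊗ᴬ β) C
  ⊗-lift f∘α≈g∘β = mkRingHom lift lift-cong (λ _ _ → refl) lift-· (λ _ → refl) refl
    (trans (*-cong f.1#-homo g.1#-homo) (*-identityˡ 1#))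
    where
    lift-cong : ∀ {s t} → s ≈⊗ t → lift s ≈ lift t
    lift-cong ≈refl           = refl
    lift-cong (≈sym e)        = sym (lift-cong e)
    lift-cong (≈trans e e′)   = trans (lift-cong e) (lift-cong e′)
    lift-cong (⊕-cong e e′)   = +-cong (lift-cong e) (lift-cong e′)
    lift-cong (⊖-cong e)      = -‿cong (lift-cong e)
    lift-cong (⊕-assoc s t u) = +-assoc _ _ _
    lift-cong (⊕-comm s t)    = +-comm _ _
    lift-cong (⊕-identityˡ s) = +-identityˡ _
    lift-cong (⊖-inverseˡ s)  = -‿inverseˡ _
    lift-cong (⊗-cong e e′)   = *-cong (f.⟦⟧-cong e) (g.⟦⟧-cong e′)
    lift-cong (⊗-distribʳ x x′ y) = trans (*-congʳ (f.+-homo x x′)) (distribʳ _ _ _)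
    lift-cong (⊗-distribˡ x y y′) = trans (*-congˡ (g.+-homo y y′)) (distribˡ _ _ _)
    lift-cong (⊗-balanced r x y)  = trans
      (*-congʳ (trans (f.*-homo _ x) (trans (*-congʳ (f∘α≈g∘β r)) (*-comm _ _))))
      (trans (*-assoc _ _ _) (*-congˡ (sym (g.*-homo _ y))))

-- Splines under flat base change.

module FlatBaseChange {R S : CRing ℓ} (φ : RingHom R S) (G : EdgeLabeledGraph R) where
  open EdgeLabeledGraph G
  private
    module R = CommutativeRing R
    module S = CommutativeRing S
    module φ = RingHom φ
    module R_G = CommutativeRing (splines G)
    module S_G′ = CommutativeRing (splines (changeBase φ G))
    module SGroup = AbelianGroupProperties S.+-abelianGroup
    module RGroup = AbelianGroupProperties R.+-abelianGroup
    module RDiff = Differences R.+-abelianGroup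
    module SDiff = Differences S.+-abelianGroup
  open Spline

  φ-sub : ∀ x y → φ.⟦ x R.- y ⟧ S.≈ φ.⟦ x ⟧ S.- φ.⟦ y ⟧
  φ-sub x y = S.trans (φ.+-homo x _) (S.+-congˡ (φ.-‿homo y))

  splineHom : RingHom (splines G) (splines (changeBase φ G))
  splineHom = mkRingHom
    (λ s → record
      { value = λ v → φ.⟦ value s v ⟧
      ; isSpline = λ e → ext-≈ (S.trans (S.*-identityˡ _) (φ-sub _ _)) (generator S.1# (isSpline s e)) })
    (λ e v → φ.⟦⟧-cong (e v))
    (λ s t v → φ.+-homo _ _)
    (λ s t v → φ.*-homo _ _)
    (λ s v → φ.-‿homo _)
    (λ v → φ.0#-homo)
    (λ v → φ.1#-homo)

  comparison : RingHom (Δ G ⊗ᴬ φ) (splines (changeBase φ G))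
  comparison = ⊗-lift splineHom (Δ (changeBase φ G)) (λ r v → S.refl)

  private
    module Φ = RingHom comparison

  -- Presents Rⱽ as a quotient too, so that `Coordinates` serves Rⱽ, Rⱽ/R_G and ∏ R/I_e alike.
  zeroSubmodule : Submodule R #vertices
  zeroSubmodule = record
    { _∈K = λ x → ∀ v → x v R.≈ R.0#
    ; ∈-resp-≈ = λ x≈y x∈ v → R.trans (R.sym (x≈y v)) (x∈ v)
    ; 0∈ = λ v → R.refl
    ; +-closed = λ x∈ y∈ v → R.trans (R.+-cong (x∈ v) (y∈ v)) (R.+-identityˡ R.0#)
    ; *-closed = λ r x∈ v → R.trans (R.*-congˡ (x∈ v)) (R.zeroʳ r) }

  splineSubmodule : Submodule R #vertices
  splineSubmodule = record
    { _∈K = λ x → ∀ e → Ideal._∈I (label e) (x (source e) R.- x (target e))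
    ; ∈-resp-≈ = λ x≈y x∈ e → Ideal.∈-resp-≈ (label e)
        (RGroup.//-cong₂ (x≈y (source e)) (x≈y (target e))) (x∈ e)
    ; 0∈ = isSpline R_G.0#
    ; +-closed = λ {x} {y} x∈ y∈ → isSpline
        (record { value = x ; isSpline = x∈ } R_G.+ record { value = y ; isSpline = y∈ })
    ; *-closed = λ r {x} x∈ → isSpline (constant G r R_G.* record { value = x ; isSpline = x∈ }) }

  labelSubmodule : Submodule R #edges
  labelSubmodule = record
    { _∈K = λ x → ∀ e → Ideal._∈I (label e) (x e)
    ; ∈-resp-≈ = λ x≈y x∈ e → Ideal.∈-resp-≈ (label e) (x≈y e) (x∈ e)
    ; 0∈ = λ e → Ideal.0∈ (label e)
    ; +-closed = λ x∈ y∈ e → Ideal.+-closed (label e) (x∈ e) (y∈ e)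
    ; *-closed = λ r x∈ e → Ideal.*-closed (label e) r (x∈ e) }

  private
    R_Gᴹ Rⱽ Rⱽ/R_G Rᴱ/I : RModule R
    R_Gᴹ   = asModule (Δ G)
    Rⱽ     = quotient zeroSubmodule
    Rⱽ/R_G = quotient splineSubmodule
    Rᴱ/I   = quotient labelSubmodule
    module Rⱽ = LeftModule Rⱽ
    module Rⱽ/R_G = LeftModule Rⱽ/R_G
    module Rᴱ/I = LeftModule Rᴱ/I
    module Cⱽ = Coordinates φ zeroSubmodule
    module C = Coordinates φ splineSubmodule
    module Cᴱ = Coordinates φ labelSubmodule

  value-isMonomorphism : LeftModuleMorphisms.IsLeftModuleMonomorphism
    (LeftModule.rawLeftModule R_Gᴹ) Rⱽ.rawLeftModule value
  value-isMonomorphism = record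
    { isLeftModuleHomomorphism = record
      { +ᴹ-isGroupHomomorphism = record
        { isMonoidHomomorphism = record
          { isMagmaHomomorphism = record
            { isRelHomomorphism = record { cong = Quotient.≋⇒≈ᴷ zeroSubmodule }
            ; homo = λ s t → Rⱽ.≈ᴹ-refl }
          ; ε-homo = Rⱽ.≈ᴹ-refl }
        ; ⁻¹-homo = λ s → Rⱽ.≈ᴹ-refl }
      ; *ₗ-homo = λ r s → Rⱽ.≈ᴹ-refl }
    ; injective = λ s≈t v → RGroup.x∙y⁻¹≈ε⇒x≈y _ _ (s≈t v) }

  ∂ : (Fin #vertices → R.Carrier) → Fin #edges → R.Carrier
  ∂ x e = x (source e) R.- x (target e)

  -- R_G is the preimage of ∏ I_e under `∂`. Well-definedness and injectivity are thus the two
  -- directions of one equivalence, up to exchanging edge differences with differences of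
  -- representatives.
  ∂-isMonomorphism : LeftModuleMorphisms.IsLeftModuleMonomorphism
    Rⱽ/R_G.rawLeftModule Rᴱ/I.rawLeftModule ∂
  ∂-isMonomorphism = record
    { isLeftModuleHomomorphism = record
      { +ᴹ-isGroupHomomorphism = record
        { isMonoidHomomorphism = record
          { isMagmaHomomorphism = record
            { isRelHomomorphism = record
              { cong = λ x≈y e → Ideal.∈-resp-≈ (label e) (RDiff.-‿-‿interchange _ _ _ _) (x≈y e) }
            ; homo = λ x y → Quotient.≋⇒≈ᴷ labelSubmodule (λ e → RDiff.-‿∙-interchange _ _ _ _) }
          ; ε-homo = Quotient.≋⇒≈ᴷ labelSubmodule (λ e → R.-‿inverseʳ R.0#) }
        ; ⁻¹-homo = λ x → Quotient.≋⇒≈ᴷ labelSubmodule (λ e → RGroup.⁻¹-∙-comm _ _) }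
      ; *ₗ-homo = λ r x → Quotient.≋⇒≈ᴷ labelSubmodule
          (λ e → R.sym (RingProperties.x[y-z]≈xy-xz R.ring r _ _)) }
    ; injective = λ ∂x≈∂y e → Ideal.∈-resp-≈ (label e) (RDiff.-‿-‿interchange _ _ _ _) (∂x≈∂y e) }

  private
    value⊗id : Tensor R R_Gᴹ (asModule φ) → Cⱽ.T
    value⊗id = _⊗id {M = R_Gᴹ} {Rⱽ} (asModule φ) value

    ∂⊗id : C.T → Cᴱ.T
    ∂⊗id = _⊗id {M = Rⱽ/R_G} {Rᴱ/I} (asModule φ) ∂

  -- Read in coordinates, `value⊗id` is the comparison map. Since coordinates determine an element
  -- of Rⱽ ⊗ S, injectivity of `value⊗id` passes to the comparison.
  coords-value : ∀ w v → Cⱽ.coords (value⊗id w) v S.≈ value Φ.⟦ w ⟧ v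
  coords-value (x ⊗ y) v = S.refl
  coords-value 𝟎       v = S.refl
  coords-value (s ⊕ t) v = S.+-cong (coords-value s v) (coords-value t v)
  coords-value (⊖ s)   v = S.-‿cong (coords-value s v)

  coords-∂ : ∀ t e → Cᴱ.coords (∂⊗id t) e S.≈ C.coords t (source e) S.- C.coords t (target e)
  coords-∂ (x ⊗ y) e = S.trans (S.*-congʳ (φ-sub _ _)) (RingProperties.[y-z]x≈yx-zx S.ring y _ _)
  coords-∂ 𝟎       e = S.sym (S.-‿inverseʳ S.0#)
  coords-∂ (s ⊕ t) e = S.trans (S.+-cong (coords-∂ s e) (coords-∂ t e)) (S.sym (SDiff.-‿∙-interchange _ _ _ _))
  coords-∂ (⊖ s)   e = S.trans (S.-‿cong (coords-∂ s e)) (S.sym (SGroup.⁻¹-∙-comm _ _))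

  open Kronecker R using (δ)

  -- Off the diagonal the entry is zero, which lies in every ideal. The family `I` is arbitrary so
  -- that the recursion can pass to `I ∘ suc`.
  *δ-∈ : ∀ {m} (I : Fin m → Ideal R) {r} i j → Ideal._∈I (I i) r → Ideal._∈I (I j) (r R.* δ i j)
  *δ-∈ I zero    zero    r∈ = Ideal.∈-resp-≈ (I zero) (R.sym (R.*-identityʳ _)) r∈
  *δ-∈ I zero    (suc j) r∈ = Ideal.∈-resp-≈ (I (suc j)) (R.sym (R.zeroʳ _)) (Ideal.0∈ (I (suc j)))
  *δ-∈ I (suc i) zero    r∈ = Ideal.∈-resp-≈ (I zero) (R.sym (R.zeroʳ _)) (Ideal.0∈ (I zero))
  *δ-∈ I (suc i) (suc j) r∈ = *δ-∈ (I ∘ suc) i j r∈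

  private
    module T = TensorProperties {R = R} Rᴱ/I (asModule φ)

  -- For a generator s φ(r) of I_e S, the scalar r moves across the tensor sign onto `δ e`, and r
  -- δ_e is zero in ∏ R/I_e because r lies in I_e.
  δ⊗-extension : ∀ e {z} → Extension φ (label e) z → _≈⊗_ {R = R} {Rᴱ/I} {asModule φ} (δ e ⊗ z) 𝟎
  δ⊗-extension e (generator s {r} r∈) = ≈trans (⊗-cong Rᴱ/I.≈ᴹ-refl (S.*-comm s φ.⟦ r ⟧))
    (≈trans (≈sym (⊗-balanced r (δ e) s))
    (≈trans (⊗-cong rδ≈0 S.refl) (T.⊗-zeroˡ s)))
    where
    rδ≈0 : (λ j → r R.* δ e j) Rᴱ/I.≈ᴹ Rᴱ/I.0ᴹ
    rδ≈0 j = Ideal.∈-resp-≈ (label j)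
      (R.sym (R.trans (R.+-congˡ RGroup.ε⁻¹≈ε) (R.+-identityʳ _))) (*δ-∈ label e j r∈)
  δ⊗-extension e ext-0       = T.⊗-zeroʳ (δ e)
  δ⊗-extension e (ext-+ p q) = ≈trans (⊗-distribˡ (δ e) _ _)
    (≈trans (⊕-cong (δ⊗-extension e p) (δ⊗-extension e q)) (⊕-identityˡ 𝟎))
  δ⊗-extension e (ext-≈ x≈y p) = ≈trans (⊗-cong Rᴱ/I.≈ᴹ-refl (S.sym x≈y)) (δ⊗-extension e p)

  open CommutativeSemigroupProperties S.+-commutativeSemigroup using (interchange)

  private
    ≈⇒comparison : ∀ {s t : C.T} → (∀ v → C.coords s v S.≈ C.coords t v) →
      ∃ λ w → ∀ v → C.coords s v S.≈ C.coords t v S.+ value Φ.⟦ w ⟧ v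
    ≈⇒comparison e = 𝟎 , λ v → S.trans (e v) (S.sym (S.+-identityʳ _))

  -- Exactness of R_G ⊗ S → Rⱽ ⊗ S → (Rⱽ / R_G) ⊗ S in the middle: a relation
  -- in the quotient fails to hold in Rⱽ ⊗ S ≅ Sⱽ only through ⊗-cong, where
  -- the discrepancy is (x - x′) ⊗ y with x - x′ a spline.

  ≈⊗⇒comparison : ∀ {s t : C.T} → s ≈⊗ t →
    ∃ λ w → ∀ v → C.coords s v S.≈ C.coords t v S.+ value Φ.⟦ w ⟧ v
  ≈⊗⇒comparison {s} ≈refl = ≈⇒comparison {s} {s} (λ v → S.refl)
  ≈⊗⇒comparison (≈sym e) = let (w , p) = ≈⊗⇒comparison e in
    ⊖ w , λ v → S.sym (S.trans (S.+-congʳ (p v)) (S.trans (S.+-assoc _ _ _)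
      (S.trans (S.+-congˡ (S.-‿inverseʳ _)) (S.+-identityʳ _))))
  ≈⊗⇒comparison (≈trans e e′) = let (w , p) = ≈⊗⇒comparison e ; (w′ , p′) = ≈⊗⇒comparison e′ in
    w′ ⊕ w , λ v → S.trans (p v) (S.trans (S.+-congʳ (p′ v)) (S.+-assoc _ _ _))
  ≈⊗⇒comparison (⊕-cong e e′) = let (w , p) = ≈⊗⇒comparison e ; (w′ , p′) = ≈⊗⇒comparison e′ in
    w ⊕ w′ , λ v → S.trans (S.+-cong (p v) (p′ v)) (interchange _ _ _ _)
  ≈⊗⇒comparison (⊖-cong e) = let (w , p) = ≈⊗⇒comparison e in
    ⊖ w , λ v → S.trans (S.-‿cong (p v)) (S.sym (SGroup.⁻¹-∙-comm _ _))
  ≈⊗⇒comparison (⊕-assoc s t u) = ≈⇒comparison {(s ⊕ t) ⊕ u} {s ⊕ (t ⊕ u)} (λ v → S.+-assoc _ _ _)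
  ≈⊗⇒comparison (⊕-comm s t) = ≈⇒comparison {s ⊕ t} {t ⊕ s} (λ v → S.+-comm _ _)
  ≈⊗⇒comparison (⊕-identityˡ s) = ≈⇒comparison {𝟎 ⊕ s} {s} (λ v → S.+-identityˡ _)
  ≈⊗⇒comparison (⊖-inverseˡ s) = ≈⇒comparison {(⊖ s) ⊕ s} {𝟎} (λ v → S.-‿inverseˡ _)
  ≈⊗⇒comparison (⊗-cong {x} {x′} {y} {y′} x≈x′ y≈y′) =
    record { isSpline = x≈x′ } ⊗ y , λ v → S.sym (begin
      φ.⟦ x′ v ⟧ S.* y′ S.+ φ.⟦ x v R.- x′ v ⟧ S.* y    ≈⟨ S.+-congʳ (S.*-congˡ (S.sym y≈y′)) ⟩
      φ.⟦ x′ v ⟧ S.* y S.+ φ.⟦ x v R.- x′ v ⟧ S.* y     ≈⟨ S.sym (S.distribʳ y _ _) ⟩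
      (φ.⟦ x′ v ⟧ S.+ φ.⟦ x v R.- x′ v ⟧) S.* y         ≈⟨ S.*-congʳ (S.sym (φ.+-homo _ _)) ⟩
      φ.⟦ x′ v R.+ (x v R.- x′ v) ⟧ S.* y
        ≈⟨ S.*-congʳ (φ.⟦⟧-cong (R.trans (R.+-comm _ _) (RGroup.//-rightDividesˡ (x′ v) (x v)))) ⟩
      φ.⟦ x v ⟧ S.* y                                   ∎)
    where open SetoidReasoning S.setoid
  ≈⊗⇒comparison (⊗-distribʳ x x′ y) = ≈⇒comparison {_ ⊗ y} {x ⊗ y ⊕ x′ ⊗ y}
    (λ v → S.trans (S.*-congʳ (φ.+-homo _ _)) (S.distribʳ _ _ _))
  ≈⊗⇒comparison (⊗-distribˡ x y y′) = ≈⇒comparison {x ⊗ _} {x ⊗ y ⊕ x ⊗ y′} (λ v → S.distribˡ _ _ _)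
  ≈⊗⇒comparison (⊗-balanced r x y) = ≈⇒comparison {_ ⊗ y} {x ⊗ _} (λ v → S.trans
    (S.*-congʳ (S.trans (φ.*-homo _ _) (S.*-comm _ _))) (S.*-assoc _ _ _))

  module _ (flat : Flat φ) where

    comparison-injective : ∀ {w w′} → Φ.⟦ w ⟧ S_G′.≈ Φ.⟦ w′ ⟧ → w ≈⊗ w′
    comparison-injective {w} {w′} e = flat R_Gᴹ Rⱽ value value-isMonomorphism
      (≈trans (Cⱽ.decompose (value⊗id w))
      (≈trans (Cⱽ.combine-cong (λ v → S.trans (coords-value w v) (S.trans (e v) (S.sym (coords-value w′ v)))))
      (≈sym (Cⱽ.decompose (value⊗id w′)))))

    combine-spline : ∀ (t : Spline (changeBase φ G)) → C.combine (value t) ≈⊗ 𝟎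
    -- `∂⊗id 𝟎` computes to `𝟎`, so injectivity reduces the claim to the vanishing of the image,
    -- which is checked on each edge coefficient.
    combine-spline t = flat Rⱽ/R_G Rᴱ/I ∂ ∂-isMonomorphism {C.combine (value t)} {𝟎}
      (≈trans (Cᴱ.decompose (∂⊗id (C.combine (value t))))
        (Cᴱ.combine-≈𝟎 _ (λ e → δ⊗-extension e (ext-≈ (S.sym (coords≈ e)) (isSpline t e)))))
      where
      coords≈ : ∀ e → Cᴱ.coords (∂⊗id (C.combine (value t))) e S.≈ value t (source e) S.- value t (target e)
      coords≈ e = S.trans (coords-∂ (C.combine (value t)) e)
        (SGroup.//-cong₂ (C.coords-combine (value t) (source e)) (C.coords-combine (value t) (target e)))

    comparison-surjective : ∀ t → ∃ λ w → Φ.⟦ w ⟧ S_G′.≈ t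
    comparison-surjective t =
      -- The coordinates of `𝟎` are zero, so the correction term `w` alone accounts for `t`.
      let (w , e) = ≈⊗⇒comparison {C.combine (value t)} {𝟎} (combine-spline t)
      in w , λ v → S.trans (S.sym (S.+-identityˡ _))
           (S.trans (S.sym (e v)) (C.coords-combine (value t) v))

    comparison-iso : AlgebraIso (inclʳ (Δ G) φ) (Δ (changeBase φ G))
    comparison-iso = record
      { to = Φ.⟦_⟧
      ; isRingIsomorphism = record
        { isRingMonomorphism = record
          { isRingHomomorphism = Φ.isRingHomomorphism
          ; injective = comparison-injective }
        ; surjective = λ t → let (w , e) = comparison-surjective t in
            w , λ {z} z≈w → S_G′.trans {Φ.⟦ z ⟧} {Φ.⟦ w ⟧} {t} (Φ.⟦⟧-cong z≈w) e }
      ; commutes = λ s v → S.trans (S.*-congʳ φ.1#-homo) (S.*-identityˡ s) }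

-- Isomorphisms of spectra from isomorphisms of algebras.

module _ (A : CRing ℓ) where
  open Spectrum A
  open TopologicalSpace zariski using (_∈ᵒ_; _≈_)
  open Section
  open FractionNear

  -- The definition of a section does not ask that it respect equality of
  -- points; this follows because it is locally a single fraction.

  common-fraction : ∀ {U} (s : Section U) {p q} → p ≈ q → (p∈ : p ∈ᵒ U) (q∈ : q ∈ᵒ U) →
    ∃₂ λ x d → ∃₂ λ (d∉p : PrimeIdeal._∉I p d) (d∉q : PrimeIdeal._∉I q d) →
      stalk._≈_ p (value s p p∈) (frac x d d∉p) × stalk._≈_ q (value s q q∈) (frac x d d∉q)
  common-fraction s {p} {q} p≈q p∈ q∈ =
    let m   = near s p p∈
        g∉q = λ h → g∉ m (proj₂ (p≈q (g m)) h)
    in x m , d m , d∉ m p (g∉ m) p∈ , d∉ m q g∉q q∈ , agrees m p (g∉ m) p∈ , agrees m q g∉q q∈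

module _ {A B C : CRing ℓ} (φ : RingHom A B) (ψ : RingHom B C) where
  private
    module C = CommutativeRing C
    module φ = RingHom φ
    module ψ = RingHom ψ
    module stalk p = CommutativeRing (Spectrum.stalk C p)

  -- The two sides evaluate a section at points that are only equal as sets of elements, hence in
  -- different stalks. A fraction representing both values is carried along both routes, where `e`
  -- identifies its images.
  Spec-map-∘ : (χ : RingHom A C) → (∀ x → ψ.⟦ φ.⟦ x ⟧ ⟧ C.≈ RingHom.⟦_⟧ χ x) →
               Spec-map φ ∘ᵐ Spec-map ψ ≈ᵐ Spec-map χ
  Spec-map-∘ χ e = record
    { point≈ = point≈
    ; pullback≈ = λ V s p p∈ →
        let (x , d , d∉ , d∉′ , s≈ , s≈′) = common-fraction A s
              {contract φ (contract ψ p)} {contract χ p} (point≈ p) _ p∈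
        in stalk.trans p (RingHom.⟦⟧-cong (stalkHom ψ p) (RingHom.⟦⟧-cong (stalkHom φ (contract ψ p)) s≈))
             (stalk.trans p {j = frac χ.⟦ x ⟧ χ.⟦ d ⟧ d∉′}
               (Localize.≈⇒~ C (complement p) (C.*-cong (e x) (C.sym (e d))))
               (stalk.sym p (RingHom.⟦⟧-cong (stalkHom χ p) s≈′))) }
    where
    module χ = RingHom χ
    point≈ : ∀ p x → _
    point≈ p x = PrimeIdeal.∈-resp-≈ p (e x) , PrimeIdeal.∈-resp-≈ p (C.sym (e x))

module _ {A B : CRing ℓ} (φ : RingHom A B) (ψ : RingHom B A) where
  private
    module A = CommutativeRing A
    module φ = RingHom φ
    module ψ = RingHom ψ
    module stalk p = CommutativeRing (Spectrum.stalk A p)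

  Spec-map-inverse : (∀ x → ψ.⟦ φ.⟦ x ⟧ ⟧ A.≈ x) → Spec-map φ ∘ᵐ Spec-map ψ ≈ᵐ idᵐ
  Spec-map-inverse e = record
    { point≈ = point≈
    ; pullback≈ = λ V s p p∈ →
        let (x , d , d∉ , d∉′ , s≈ , s≈′) = common-fraction A s
              {contract φ (contract ψ p)} {p} (point≈ p) _ p∈
        in stalk.trans p (RingHom.⟦⟧-cong (stalkHom ψ p) (RingHom.⟦⟧-cong (stalkHom φ (contract ψ p)) s≈))
             (stalk.trans p {j = frac x d d∉′}
               (Localize.≈⇒~ A (complement p) (A.*-cong (e x) (A.sym (e d))))
               (stalk.sym p s≈′)) }
    where
    point≈ : ∀ p x → _
    point≈ p x = PrimeIdeal.∈-resp-≈ p (e x) , PrimeIdeal.∈-resp-≈ p (A.sym (e x))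

module _ {R A B : CRing ℓ} {α : RingHom R A} {β : RingHom R B} (iso : AlgebraIso α β) where
  private
    module A = CommutativeRing A
    module B = CommutativeRing B
  open AlgebraIso iso
  open RingMorphisms.IsRingIsomorphism isRingIsomorphism

  private
    toʰ : RingHom A B
    toʰ = record { ⟦_⟧ = to ; isRingHomomorphism = isRingHomomorphism }

    from : B.Carrier → A.Carrier
    from y = proj₁ (surjective y)

    to-from : ∀ y → to (from y) B.≈ y
    to-from y = proj₂ (surjective y) A.refl

    -- `from` is a choice of preimages; injectivity of `to` forces every law for it from the
    -- corresponding law for `to`.
    from-unique : ∀ {y x} → y B.≈ to x → from y A.≈ x
    from-unique {y} e = injective (B.trans (to-from y) e)

    fromʰ : RingHom B A
    fromʰ = mkRingHom from
      (λ {x} {y} e → from-unique (B.trans e (B.sym (to-from y))))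
      (λ x y → from-unique (B.sym (B.trans (+-homo _ _) (B.+-cong (to-from x) (to-from y)))))
      (λ x y → from-unique (B.sym (B.trans (*-homo _ _) (B.*-cong (to-from x) (to-from y)))))
      (λ x → from-unique (B.sym (B.trans (-‿homo _) (B.-‿cong (to-from x)))))
      (from-unique (B.sym 0#-homo))
      (from-unique (B.sym 1#-homo))

  Spec-iso : IsoOver (Spec-map α) (Spec-map β)
  Spec-iso = record
    -- Contravariance: the map from Spec A to Spec B comes from the ring map from B to A.
    { to = Spec-map fromʰ
    ; from = Spec-map toʰ
    ; from∘to = Spec-map-inverse toʰ fromʰ (λ x → from-unique B.refl)
    ; to∘from = Spec-map-inverse fromʰ toʰ to-from
    ; over = Spec-map-∘ β fromʰ α (λ r → from-unique (B.sym (commutes r))) }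

-- Splines and localization.

module CommonMultiple {A : CRing ℓ} (M : MultiplicativeSet A) where
  open CommutativeRing A hiding (zero)
  open MultiplicativeSet M

  -- The product of all `a i` works. Finiteness of the vertex and edge sets enters the localization
  -- argument through this lemma.
  commonMultiple : ∀ {n} (a : Fin n → Carrier) → (∀ i → a i ∈M) →
                   ∃ λ b → b ∈M × ∀ i → ∃ λ c → b ≈ c * a i
  commonMultiple {ℕ.zero}  a a∈ = 1# , 1∈ , λ ()
  commonMultiple {ℕ.suc n} a a∈ =
    let (b , b∈ , div) = commonMultiple (a ∘ suc) (a∈ ∘ suc) in
    b * a zero , *-closed b∈ (a∈ zero) , λ
      { zero    → b , refl
      ; (suc i) → let (c , b≈) = div i in
          a zero * c , trans (*-comm b (a zero)) (trans (*-congˡ b≈) (sym (*-assoc _ _ _))) }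

module LocalizedSplines {R : CRing ℓ} (G : EdgeLabeledGraph R) (M : MultiplicativeSet R) where
  open CommutativeRing R hiding (zero)
  open EdgeLabeledGraph G
  open MultiplicativeSet M using (_∈M; 1∈; *-closed; ∈-resp-≈)
  open RingProperties ring using (-‿distribʳ-*; x[y-z]≈xy-xz)
  open Solver commutativeSemiring using (solve; _:=_; _:+_; _:*_; con)
  open SetoidReasoning setoid
  open CommonMultiple M
  open Spline
  open Localize R M using (via; ≈⇒~; _~_)
  private
    module R_G = CommutativeRing (splines G)
    R[M⁻¹] = localization R M
    module R[M⁻¹] = CommutativeRing R[M⁻¹]
    module R[M⁻¹]_G = CommutativeRing (splines (changeBase (toLocalization R M) G))

  evaluate : Fin #vertices → RingHom (splines G) R
  evaluate v = mkRingHom (λ s → value s v) (λ e → e v) (λ _ _ → refl) (λ _ _ → refl) (λ _ → refl) refl refl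

  -- Putting fractions over a common denominator multiplies numerators by ring elements, so they
  -- stay in `I` and a sum of generators collapses to one fraction.
  extension-fraction : ∀ I {z} → Extension (toLocalization R M) I z →
    ∃ λ r → Ideal._∈I I r × ∃ λ m → ∃ λ (m∈ : m ∈M) → z ~ frac r m m∈
  extension-fraction I (generator (frac a m m∈) r∈) =
    _ , Ideal.*-closed I a r∈ , m * 1# , *-closed m∈ 1∈ , R[M⁻¹].refl
  extension-fraction I ext-0 = 0# , Ideal.0∈ I , 1# , 1∈ , R[M⁻¹].refl
  extension-fraction I (ext-+ p q) =
    let (r , r∈ , m , m∈ , e)      = extension-fraction I p
        (r′ , r′∈ , m′ , m′∈ , e′) = extension-fraction I q
    in r * m′ + r′ * m
     , Ideal.+-closed I (Ideal.∈-resp-≈ I (*-comm m′ r) (Ideal.*-closed I m′ r∈))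
                        (Ideal.∈-resp-≈ I (*-comm m r′) (Ideal.*-closed I m r′∈))
     , m * m′ , *-closed m∈ m′∈ , Localize.+ᶠ-cong R M e e′
  extension-fraction I (ext-≈ x≈y p) =
    let (r , r∈ , m , m∈ , e) = extension-fraction I p
    in r , r∈ , m , m∈ , R[M⁻¹].trans (R[M⁻¹].sym x≈y) e

  -- c * a and c′ * a′ are the numerators over the common denominator B.

  clear-denominators : ∀ I {a b b∈ a′ b′ b′∈ B c c′} → B ∈M → B ≈ c * b → B ≈ c′ * b′ →
    Extension (toLocalization R M) I (frac a b b∈ R[M⁻¹].- frac a′ b′ b′∈) →
    ∃ λ k → k ∈M × Ideal._∈I I (k * (c * a - c′ * a′))
  clear-denominators I {a} {b} {_} {a′} {b′} {_} {B} {c} {c′} B∈ B≈cb B≈c′b′ z∈ =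
    let (r , r∈ , m , m∈ , via w w∈ e) = extension-fraction I z∈ in
    -- Here `e` is a/b - a′/b′ = r/m cross-multiplied, with witness `w`. Replacing `B` by c′ b′ in
    -- one summand and by c b in the other lets c c′ factor out, after which `e` applies.
    (w * m) * B , *-closed (*-closed w∈ m∈) B∈ ,
    Ideal.∈-resp-≈ I (sym (begin
      ((w * m) * B) * (c * a - c′ * a′)
        ≈⟨ *-congˡ (+-congˡ (-‿distribʳ-* c′ a′)) ⟩
      ((w * m) * B) * (c * a + c′ * - a′)
        ≈⟨ distribˡ _ _ _ ⟩
      ((w * m) * B) * (c * a) + ((w * m) * B) * (c′ * - a′)
        ≈⟨ +-cong (*-congʳ (*-congˡ B≈c′b′)) (*-congʳ (*-congˡ B≈cb)) ⟩
      ((w * m) * (c′ * b′)) * (c * a) + ((w * m) * (c * b)) * (c′ * - a′)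
        ≈⟨ solve 8 (λ w m c b c′ b′ a a′ →
             ((w :* m) :* (c′ :* b′)) :* (c :* a) :+ ((w :* m) :* (c :* b)) :* (c′ :* a′)
             := (c :* c′) :* (w :* ((a :* b′ :+ a′ :* b) :* m))) refl w m c b c′ b′ a (- a′) ⟩
      (c * c′) * (w * ((a * b′ + (- a′) * b) * m))
        ≈⟨ *-congˡ e ⟩
      (c * c′) * (w * (r * (b * b′)))
        ≈⟨ solve 6 (λ c c′ w r b b′ →
             (c :* c′) :* (w :* (r :* (b :* b′))) := ((c :* c′) :* (w :* (b :* b′))) :* r) refl c c′ w r b b′ ⟩
      ((c * c′) * (w * (b * b′))) * r ∎)) (Ideal.*-closed I _ r∈)

  -- The hypotheses say that `N` is the image of `M` up to equality of splines; this covers both the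
  -- image of the complement of a prime and the powers of a constant spline.
  module _ (N : MultiplicativeSet (splines G))
           (ΔM⊆N : ∀ {x} → x ∈M → MultiplicativeSet._∈M N (constant G x))
           (N⊆ΔM : ∀ {t} → MultiplicativeSet._∈M N t → ∃ λ x → x ∈M × constant G x R_G.≈ t)
           where
    open MultiplicativeSet N using () renaming (_∈M to _∈N)
    private
      R_G[N⁻¹] = localization (splines G) N
      module R_G[N⁻¹] = CommutativeRing R_G[N⁻¹]

    value∈M : ∀ {t} → t ∈N → ∀ v → value t v ∈M
    value∈M t∈ v = let (x , x∈ , e) = N⊆ΔM t∈ in ∈-resp-≈ (e v) x∈

    evaluate[_] : Fin #vertices → RingHom R_G[N⁻¹] R[M⁻¹]
    evaluate[ v ] = localizeHom (evaluate v) N M (λ t∈ → value∈M t∈ v)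

    private
      module ev v = RingHom evaluate[ v ]

    localizedSpline : R_G[N⁻¹].Carrier → Spline (changeBase (toLocalization R M) G)
    localizedSpline p@(frac s t t∈) = record
      { value = λ v → ev.⟦_⟧ v p
      -- The denominator is a constant spline x, so the edge difference is (1/x) times that of `s`,
      -- a generator of the extended ideal.
      ; isSpline = λ e → let (x , x∈ , Δx≈t) = N⊆ΔM t∈ in
          ext-≈ (≈⇒~ (difference (Δx≈t (source e)) (Δx≈t (target e))))
            (generator (frac 1# x x∈) (isSpline s e)) }
      where
      difference : ∀ {x a b c d} → x ≈ c → x ≈ d →
        (1# * (a - b)) * (c * d) ≈ (a * d + (- b) * c) * (x * 1#)
      difference {x} {a} {b} {c} {d} x≈c x≈d = begin
        (1# * (a - b)) * (c * d)
          ≈⟨ *-congˡ (*-cong (sym x≈c) (sym x≈d)) ⟩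
        (1# * (a - b)) * (x * x)
          ≈⟨ solve 3 (λ a b x → (con 1 :* (a :+ b)) :* (x :* x) := (a :* x :+ b :* x) :* (x :* con 1)) refl a (- b) x ⟩
        (a * x + (- b) * x) * (x * 1#)
          ≈⟨ *-congʳ (+-cong (*-congˡ x≈d) (*-congˡ x≈c)) ⟩
        (a * d + (- b) * c) * (x * 1#) ∎

    localizedSplineHom : RingHom R_G[N⁻¹] (splines (changeBase (toLocalization R M) G))
    localizedSplineHom = mkRingHom localizedSpline
      (λ e v → ev.⟦⟧-cong v e)
      (λ p q v → ev.+-homo v p q)
      (λ p q v → ev.*-homo v p q)
      (λ p v → ev.-‿homo v p)
      (λ v → ev.0#-homo v)
      (λ v → ev.1#-homo v)

    -- Equality at each vertex has its own witness; a common multiple of these gives a constant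
    -- spline that witnesses all of them at once.
    localizedSpline-injective : ∀ {p q} →
      localizedSpline p R[M⁻¹]_G.≈ localizedSpline q → p R_G[N⁻¹].≈ q
    localizedSpline-injective {p} {q} e =
      let (W , W∈ , div) = commonMultiple (_~_.witness ∘ e) (_~_.witness∈ ∘ e) in
      Localize.via (constant G W) (ΔM⊆N W∈) (λ v → let (c , W≈) = div v in begin
        W * (value (num p) v * value (den q) v)
          ≈⟨ trans (*-congʳ W≈) (*-assoc c _ _) ⟩
        c * (_~_.witness (e v) * (value (num p) v * value (den q) v))
          ≈⟨ *-congˡ (_~_.identity~ (e v)) ⟩
        c * (_~_.witness (e v) * (value (num q) v * value (den p) v))
          ≈⟨ sym (trans (*-congʳ W≈) (*-assoc c _ _)) ⟩
        W * (value (num q) v * value (den p) v) ∎)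

    -- `B` is a common denominator, so the value at v is c_v a_v / B. The numerators c_v a_v meet
    -- the edge conditions only after multiplication by elements of `M`; `D` is a common multiple of
    -- those, and the preimage has denominator D B.
    localizedSpline-surjective : ∀ σ → ∃ λ p → localizedSpline p R[M⁻¹]_G.≈ σ
    localizedSpline-surjective σ = frac s (constant G (D * B)) (ΔM⊆N (*-closed D∈ B∈)) , λ v → ≈⇒~ (begin
        (D * (c v * a v)) * b v  ≈⟨ solve 4 (λ D c a b → (D :* (c :* a)) :* b := a :* (D :* (c :* b))) refl D (c v) (a v) (b v) ⟩
        a v * (D * (c v * b v))  ≈⟨ *-congˡ (*-congˡ (sym (B≈cb v))) ⟩
        a v * (D * B)            ∎)
      where
      a b : Fin #vertices → Carrier
      a v = num (value σ v)
      b v = den (value σ v)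
      denominators = commonMultiple b (λ v → den∈ (value σ v))
      B = proj₁ denominators
      B∈ = proj₁ (proj₂ denominators)
      c : Fin #vertices → Carrier
      c v = proj₁ (proj₂ (proj₂ denominators) v)
      B≈cb : ∀ v → B ≈ c v * b v
      B≈cb v = proj₂ (proj₂ (proj₂ denominators) v)
      cleared : ∀ e → ∃ λ k → k ∈M ×
        Ideal._∈I (label e) (k * (c (source e) * a (source e) - c (target e) * a (target e)))
      cleared e = clear-denominators (label e) B∈ (B≈cb (source e)) (B≈cb (target e)) (isSpline σ e)
      multipliers = commonMultiple (proj₁ ∘ cleared) (proj₁ ∘ proj₂ ∘ cleared)
      D = proj₁ multipliers
      D∈ = proj₁ (proj₂ multipliers)
      s : Spline G
      s = record
        { value = λ v → D * (c v * a v)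
        ; isSpline = λ e → let (k , D≈) = proj₂ (proj₂ multipliers) e in
            Ideal.∈-resp-≈ (label e)
              (trans (sym (*-assoc _ _ _)) (trans (*-congʳ (sym D≈)) (x[y-z]≈xy-xz D _ _)))
              (Ideal.*-closed (label e) k (proj₂ (proj₂ (cleared e)))) }

    localizedSpline-iso : AlgebraIso (localizeHom (Δ G) M N ΔM⊆N) (Δ (changeBase (toLocalization R M) G))
    localizedSpline-iso = record
      { to = localizedSpline
      ; isRingIsomorphism = record
        { isRingMonomorphism = record
          { isRingHomomorphism = RingHom.isRingHomomorphism localizedSplineHom
          ; injective = λ {p} {q} → localizedSpline-injective {p} {q} }
        ; surjective = λ σ → let (p , e) = localizedSpline-surjective σ in
            p , λ {q} q≈p → R[M⁻¹]_G.trans {localizedSpline q} {localizedSpline p} {σ}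
                  (RingHom.⟦⟧-cong localizedSplineHom {q} {p} q≈p) e }
      ; commutes = λ r v → ≈⇒~ refl }

-- Shows that each power of the constant spline f comes from a power of f in R, as `N⊆ΔM` demands.
constant-^ : {R : CRing ℓ} (G : EdgeLabeledGraph R) (f : CommutativeRing.Carrier R) (n : ℕ) →
  CommutativeRing._≈_ (splines G) (constant G (Exp._^_ (CommutativeRing.semiring R) f n))
    (Exp._^_ (CommutativeRing.semiring (splines G)) (constant G f) n)
constant-^ {R = R} G f ℕ.zero    v = CommutativeRing.refl R
constant-^ {R = R} G f (ℕ.suc n) v = CommutativeRing.*-congˡ R (constant-^ G f n v)

theorem3 : ∀ {ℓ} (R : CommutativeRing ℓ ℓ) (G : EdgeLabeledGraph R) →
    ((S : CommutativeRing ℓ ℓ) (φ : RingHom R S) → Flat φ →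
    IsoOver (baseChange (Δ G) φ) (splineStructureMorphism (changeBase φ G)))
    × ((p : PrimeIdeal R) →
    AlgebraIso (Δ-at-prime G p) (Δ (changeBase (toLocalization R (complement p)) G)))
    × ((f : CommutativeRing.Carrier R) →
    AlgebraIso (Δ-away G f) (Δ (changeBase (toLocalization R (powers R f)) G)))
theorem3 R G =
    (λ S φ flat → Spec-iso {α = inclʳ (Δ G) φ} {β = Δ (changeBase φ G)}
      (FlatBaseChange.comparison-iso φ G flat))
  -- Membership in `image` is by definition the existence statement that `N⊆ΔM` asks for, so the
  -- identity serves.
  , (λ p → LocalizedSplines.localizedSpline-iso G (complement p) (image (Δ G) (complement p)) _ (λ t∈ → t∈))
  , λ f → LocalizedSplines.localizedSpline-iso G (powers R f) (powers (splines G) (constant G f)) _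
      (λ { (n , t≈fⁿ) → _ , (n , R.refl) , λ v → R.trans (constant-^ G f n v) (R.sym (t≈fⁿ v)) })
  where module R = CommutativeRing R
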